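{- Let $m\geq 2$ be an integer. (1) Let $n\geq 3$, let $G=\langle x,y:~x^n=y^2=e,~yxy=x^{ -1}\rangle$, $A=\langle x\rangle$, and let $D\subseteq A$ be a difference set in $A$ with parameters $\left(n,\frac{2n-1-\sqrt{8n-7}}{2},n+1-\sqrt{8n-7}\right)$, and $\Gamma(D)=\mathrm{Cay}(G,A^\#\cup yD)$. Then the lexicographic product $K_m[\Gamma(D)]$ is a strictly Deza dihedrant of WL-rank $5$. (2) The graph $K_m[K_4\times K_2]$ is a strictly Deza dihedrant of WL-rank $5$.
   Context: All graphs are finite, undirected, without loops and multiple edges. For a finite group $G$ with identity $e$, $G^\#=G\setminus\{e\}$. For $S\subseteq G$ with $e\notin S$, $S=S^{ -1}$, $\mathrm{Cay}(G,S)$ has vertex set $G$ and edges $\{g,sg\}$, $g\in G$, $s\in S$. A dihedrant is a graph isomorphic to a Cayley graph over a dihedral group. A subset $D$ of a group $H$ is a difference set with parameters $(v,k,\lambda)$ if $|H|=v$, $|D|=k$, $\lambda$ is a positive integer, and every element of $H^\#$ is $d_1^{ -1}d_2$ ($d_1,d_2\in D$) in exactly $\lambda$ ways. A $k$-regular graph on $n$ vertices is a Deza graph if there are nonnegative integers $a,b$ such that every pair of distinct vertices has either $a$ or $b$ common neighbours. A strictly Deza graph is a Deza graph that is not strongly regular and has diameter $2$. The WL-rank of a graph $\Gamma=(V,E)$ is the number of classes of the smallest coherent configuration on $V$ such that $E$ is a union of classes (for Cayley graphs $\mathrm{Cay}(G,S)$: the number of basic sets of the smallest S-ring over $G$ in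 which $S$ is a union of basic sets). $K_m$ is the complete graph; $\Gamma_1\times\Gamma_2$ is the Cartesian product; the lexicographic product $\Gamma_1[\Gamma_2]$ has vertex set $V_1\times V_2$ with $(v_1,v_2)\sim(u_1,u_2)$ iff $v_1\sim u_1$ in $\Gamma_1$, or $v_1=u_1$ and $v_2\sim u_2$ in $\Gamma_2$. -}

module Defs where

open import Data.Nat using (ℕ; zero; suc; _+_; _*_; _∸_; _≤_; NonZero)
open import Data.Nat.DivMod using (_mod_)
open import Data.Fin using (Fin; toℕ) renaming (zero to fz; suc to fs)
import Data.Fin as F
open import Data.Fin.Properties using (*↔×)
open import Data.Bool using (Bool; true; false; _∧_; _∨_; not; if_then_else_)
open import Data.List using (List; length; filter)
open import Data.Vec.Functional using (Vector)
open import Data.Product using (Σ; ∃; _×_; _,_; proj₁; proj₂)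
open import Data.Product.Function.NonDependent.Propositional using (_×-↔_)
open import Data.Sum using (_⊎_)
open import Function.Bundles using (_↔_; Inverse)
open import Function.Construct.Composition using (_↔-∘_)
open import Function.Construct.Identity using (↔-id)
open import Function.Construct.Symmetry using (↔-sym)
open import Relation.Nullary using (¬_; Dec; yes; no)
open import Relation.Nullary.Decidable using (⌊_⌋)
open import Relation.Binary.Definitions using (DecidableEquality)
open import Relation.Binary.PropositionalEquality using (_≡_; _≢_)
import Data.List as L

count : (N : ℕ) → (Fin N → Bool) → ℕ
count N p = length (filter (λ i → Data.Bool._≟_ (p i) true) (L.allFin N))
  where import Data.Bool

record Graph : Set₁ where
  field
    V    : Set
    size : ℕ
    enum : Fin size ↔ V
    _≟V_ : DecidableEquality V
    adj  : V → V → Bool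

  vertex : Fin size → V
  vertex = Inverse.to enum

  numV : (V → Bool) → ℕ
  numV p = count size (λ i → p (vertex i))

  common : V → V → ℕ
  common u v = numV (λ w → adj u w ∧ adj w v)

  degree : V → ℕ
  degree u = numV (λ w → adj u w)

open Graph public

Adj : (Γ : Graph) → V Γ → V Γ → Set
Adj Γ u v = adj Γ u v ≡ true

Regular : Graph → ℕ → Set
Regular Γ k = ∀ u → degree Γ u ≡ k

IsDeza : Graph → Set
IsDeza Γ = Σ ℕ λ k → Regular Γ k × Σ ℕ λ a → Σ ℕ λ b →
  (∀ u v → u ≢ v → common Γ u v ≡ a ⊎ common Γ u v ≡ b)

IsSRG : Graph → Set
IsSRG Γ = Σ ℕ λ k → Regular Γ k × Σ ℕ λ l → Σ ℕ λ μ →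
  (∀ u v → u ≢ v → Adj Γ u v → common Γ u v ≡ l) ×
  (∀ u v → u ≢ v → ¬ Adj Γ u v → common Γ u v ≡ μ)

Dist≤2 : (Γ : Graph) → V Γ → V Γ → Set
Dist≤2 Γ u v = u ≡ v ⊎ Adj Γ u v ⊎ Σ (V Γ) λ w → Adj Γ u w × Adj Γ w v

Diameter2 : Graph → Set
Diameter2 Γ = (∀ u v → Dist≤2 Γ u v) ×
  Σ (V Γ) λ u → Σ (V Γ) λ v → u ≢ v × ¬ Adj Γ u v

IsStrictlyDeza : Graph → Set
IsStrictlyDeza Γ = IsDeza Γ × ¬ IsSRG Γ × Diameter2 Γ

-- Coherent configurations on V, given by a colouring of V × V with
-- r colours (the colour classes are the basis relations).

module _ (Γ : Graph) where
  open Graph Γ using () renaming (V to W)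

  record IsCC (r : ℕ) (c : W → W → Fin r) : Set where
    field
      nonempty : ∀ i → Σ W λ u → Σ W λ v → c u v ≡ i
      diagonal : ∀ u v w → c v w ≡ c u u → v ≡ w
      transpose : ∀ u v u' v' → c u v ≡ c u' v' → c v u ≡ c v' u'
      intersection : ∀ (i j : Fin r) u v u' v' → c u v ≡ c u' v' →
        (numV Γ (λ w → ⌊ c u w F.≟ i ⌋ ∧ ⌊ c w v F.≟ j ⌋)) ≡
        (numV Γ (λ w → ⌊ c u' w F.≟ i ⌋ ∧ ⌊ c w v' F.≟ j ⌋))

  EdgesUnion : (r : ℕ) → (W → W → Fin r) → Set
  EdgesUnion r c = ∀ u v u' v' → c u v ≡ c u' v' → adj Γ u v ≡ adj Γ u' v'

  Refines : (r' r : ℕ) → (W → W → Fin r') → (W → W → Fin r) → Set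
  Refines r' r c' c = ∀ u v u' v' → c' u v ≡ c' u' v' → c u v ≡ c u' v'

  WLRank : ℕ → Set
  WLRank r = Σ (W → W → Fin r) λ c → IsCC r c × EdgesUnion r c ×
    (∀ r' (c' : W → W → Fin r') → IsCC r' c' → EdgesUnion r' c' →
       Refines r' r c' c)

-- Dihedral group of order 2n, D = ⟨x,y : xⁿ = y² = e, yxy = x⁻¹⟩.
-- The pair (i , b) stands for x^i y^b  (i : ℤ/n, b : ℤ/2).

module _ (n : ℕ) .{{_ : NonZero n}} where

  Dih : Set
  Dih = Fin n × Fin 2

  _+ₙ_ : Fin n → Fin n → Fin n
  i +ₙ j = (toℕ i + toℕ j) mod n

  -ₙ_ : Fin n → Fin n
  -ₙ i = (n ∸ toℕ i) mod n

  0ₙ : Fin n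
  0ₙ = 0 mod n

  _⊕₂_ : Fin 2 → Fin 2 → Fin 2
  fz ⊕₂ b = b
  fs fz ⊕₂ fz = fs fz
  fs fz ⊕₂ fs fz = fz

  -- (x^i y^a)(x^j y^b) = x^(i + (-1)^a j) y^(a+b)
  _∙_ : Dih → Dih → Dih
  (i , fz) ∙ (j , b) = (i +ₙ j , b)
  (i , fs fz) ∙ (j , b) = (i +ₙ (-ₙ j) , fs fz ⊕₂ b)

  e : Dih
  e = (0ₙ , fz)

  _⁻¹ : Dih → Dih
  (i , fz) ⁻¹ = (-ₙ i , fz)
  (i , fs fz) ⁻¹ = (i , fs fz)

  xpow : Fin n → Dih
  xpow i = (i , fz)

  y : Dih
  y = (0ₙ , fs fz)

  -- Cayley graph Cay(D, S): g ~ h iff h = s g for some s ∈ S,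
  -- i.e. iff h g⁻¹ ∈ S.
  CayAdj : (Dih → Bool) → Dih → Dih → Bool
  CayAdj S g h = S (h ∙ (g ⁻¹))

  DihEnum : Fin (n * 2) ↔ Dih
  DihEnum = *↔×

  record IsDihCayley (Γ : Graph) : Set where
    field
      S      : Dih → Bool
      noId   : S e ≡ false
      invCl  : ∀ g → S (g ⁻¹) ≡ S g
      iso    : V Γ ↔ Dih
      isoAdj : ∀ u v → adj Γ u v ≡ CayAdj S (Inverse.to iso u) (Inverse.to iso v)

  -- A = ⟨x⟩ ≅ ℤ/n; a subset D ⊆ A is given by the set of exponents
  -- {i : x^i ∈ D} (a Bool predicate on Fin n).

  IsDifferenceSet : (Fin n → Bool) → ℕ → ℕ → ℕ → Set
  IsDifferenceSet D v k l =
    v ≡ n × count n D ≡ k × 1 ≤ l ×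
    (∀ h → h ≢ 0ₙ →
      count (n * n) (λ p → let (d₁ , d₂) = Inverse.to (*↔× {n} {n}) p in
        D d₁ ∧ D d₂ ∧ ⌊ ((xpow d₁ ⁻¹) ∙ xpow d₂) ≟D xpow h ⌋) ≡ l)
    where
    _≟D_ : DecidableEquality Dih
    (a , b) ≟D (c , d) with a F.≟ c | b F.≟ d
    ... | yes Relation.Binary.PropositionalEquality.refl | yes Relation.Binary.PropositionalEquality.refl = yes Relation.Binary.PropositionalEquality.refl
    ... | no p | _ = no λ { Relation.Binary.PropositionalEquality.refl → p Relation.Binary.PropositionalEquality.refl }
    ... | yes _ | no q = no λ { Relation.Binary.PropositionalEquality.refl → q Relation.Binary.PropositionalEquality.refl }

  SD : (Fin n → Bool) → Dih → Bool
  SD D (i , fz) = not ⌊ i F.≟ 0ₙ ⌋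
  SD D (i , fs fz) = D (proj₁ (y ∙ (i , fs fz)))   -- g ∈ yD iff y⁻¹g = yg ∈ D

  ΓD : (Fin n → Bool) → Graph
  ΓD D = record
    { V = Dih ; size = n * 2 ; enum = DihEnum
    ; _≟V_ = λ a b → ≟P a b
    ; adj = CayAdj (SD D) }
    where
    ≟P : DecidableEquality Dih
    ≟P (a , b) (c , d) with a F.≟ c | b F.≟ d
    ... | yes Relation.Binary.PropositionalEquality.refl | yes Relation.Binary.PropositionalEquality.refl = yes Relation.Binary.PropositionalEquality.refl
    ... | no p | _ = no λ { Relation.Binary.PropositionalEquality.refl → p Relation.Binary.PropositionalEquality.refl }
    ... | yes _ | no q = no λ { Relation.Binary.PropositionalEquality.refl → q Relation.Binary.PropositionalEquality.refl }

IsDihedrant : Graph → Set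
IsDihedrant Γ = Σ ℕ λ n → Σ (NonZero n) λ nz → IsDihCayley n {{nz}} Γ

K : ℕ → Graph
K m = record { V = Fin m ; size = m ; enum = ↔-id _ ; _≟V_ = F._≟_
             ; adj = λ a b → not ⌊ a F.≟ b ⌋ }

module _ (Γ₁ Γ₂ : Graph) where
  private
    ≟× : DecidableEquality (V Γ₁ × V Γ₂)
    ≟× (a , b) (c , d) with _≟V_ Γ₁ a c | _≟V_ Γ₂ b d
    ... | yes Relation.Binary.PropositionalEquality.refl | yes Relation.Binary.PropositionalEquality.refl = yes Relation.Binary.PropositionalEquality.refl
    ... | no p | _ = no λ { Relation.Binary.PropositionalEquality.refl → p Relation.Binary.PropositionalEquality.refl }
    ... | yes _ | no q = no λ { Relation.Binary.PropositionalEquality.refl → q Relation.Binary.PropositionalEquality.refl }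

    enum× : Fin (size Γ₁ * size Γ₂) ↔ (V Γ₁ × V Γ₂)
    enum× = (enum Γ₁ ×-↔ enum Γ₂) ↔-∘ *↔×

  Cart : Graph
  Cart = record { V = V Γ₁ × V Γ₂ ; size = size Γ₁ * size Γ₂ ; enum = enum×
    ; _≟V_ = ≟×
    ; adj = λ { (a , b) (c , d) →
        (⌊ _≟V_ Γ₁ a c ⌋ ∧ adj Γ₂ b d) ∨ (adj Γ₁ a c ∧ ⌊ _≟V_ Γ₂ b d ⌋) } }

  Lex : Graph
  Lex = record { V = V Γ₁ × V Γ₂ ; size = size Γ₁ * size Γ₂ ; enum = enum×
    ; _≟V_ = ≟×
    ; adj = λ { (a , b) (c , d) →
        adj Γ₁ a c ∨ (⌊ _≟V_ Γ₁ a c ⌋ ∧ adj Γ₂ b d) } }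

{-# OPTIONS --safe #-}

-- Γ(D) is a pair of n-cliques joined along the incidence matrix of the symmetric
-- design of translates of D, and K₄ × K₂ is the same graph for n = 4, |D| = 1 (where λ = 0).
-- The relations "equal, same clique, cross edge, cross non-edge" form a coherent
-- configuration, because a design fixes all path counts. The parameters make the
-- common neighbour numbers 2k, 2k − 2, 2k on the three non-trivial relations.
-- In K_m[Γ] one more relation, "different copies", appears, and twice the degree of
-- Γ is 2n + 2k − 2, so its common neighbour number agrees with that of a cross edge:
-- the product is a Deza graph, and both values occur on edges, so it is not strongly
-- regular. A coherent configuration refining the edges sees adjacency and common
-- neighbour numbers, which separate everything except cross edges from pairs in
-- different copies; these differ in whether the clique of one end contains a
-- non-neighbour of the other.

module Submission where

open import Defs
open import Data.Bool using (Bool; true; false; _∧_; _∨_; not; if_then_else_)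
open import Data.Bool.Properties using (∧-comm; ∧-identityʳ; ∧-zeroʳ; ∧-idem; not-injective)
open import Data.Empty using (⊥)
open import Data.Fin using (Fin; zero; suc; toℕ; combine; remQuot; _↑ˡ_; _↑ʳ_; _≟_)
open import Data.Fin.Patterns using (0F; 1F; 2F; 3F; 4F)
open import Data.Fin.Properties using
  (*↔×; remQuot-combine; combine-remQuot; toℕ-combine; toℕ-fromℕ<; toℕ-injective; toℕ<n; toℕ≤n; suc-injective; all?)
open import Data.List using (length; filter; tabulate)
open import Data.Nat using (ℕ; zero; suc; _+_; _*_; _∸_; _≤_; _<_; z≤n; s≤s; NonZero)
open import Data.Nat.DivMod using (_mod_; _%_; _/_; m≡m%n+[m/n]*n; m<n⇒m%n≡m; [m+kn]%n≡m%n; m%n<n; m*n%n≡0)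
open import Data.Nat.Properties hiding (_≟_; suc-injective)
open import Data.Nat.Tactic.RingSolver using (solve-∀)
open import Data.Product using (Σ; ∃; _×_; _,_; proj₁; proj₂)
open import Data.Product.Function.NonDependent.Propositional using (_×-↔_)
open import Data.Sum using (_⊎_; inj₁; inj₂)
open import Function using (_∘_; id; case_of_)
open import Function.Bundles using (_↔_; Inverse; mk↔ₛ′)
open import Function.Construct.Composition using (_↔-∘_)
open import Function.Construct.Identity using (↔-id)
open import Function.Construct.Symmetry using (↔-sym)
open import Relation.Binary.Definitions using (DecidableEquality)
open import Relation.Binary.PropositionalEquality
open import Relation.Nullary using (yes; no; contradiction; ¬_; Dec)
open import Relation.Nullary.Decidable using (⌊_⌋; from-yes; ¬?; _→-dec_)
open import Algebra.Properties.Semiring.Sum +-*-semiring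
import Data.Bool as Bool
import Data.Integer.Properties as ℤ
import Data.Integer.Tactic.RingSolver as ℤ
import Data.Nat as ℕ

open ≡-Reasoning

-- Sums and counting over finite sets

bit : Bool → ℕ
bit true  = 1
bit false = 0

filter-sum : ∀ {n} {A : Set} (p : A → Bool) (f : Fin n → A) →
  length (filter (λ x → p x Bool.≟ true) (tabulate f)) ≡ sum (bit ∘ p ∘ f)
filter-sum {zero}  p f = refl
filter-sum {suc n} p f with p (f zero)
... | true  = cong suc (filter-sum p (f ∘ suc))
... | false = filter-sum p (f ∘ suc)

count-sum : ∀ {n} (p : Fin n → Bool) → count n p ≡ sum (bit ∘ p)
count-sum p = filter-sum p id

sum-const : ∀ n x → sum {n} (λ _ → x) ≡ n * x
sum-const zero    x = refl
sum-const (suc n) x = cong (x +_) (sum-const n x)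

sum-+ : ∀ a {b} (f : Fin (a + b) → ℕ) →
  sum f ≡ sum (λ i → f (i ↑ˡ b)) + sum (λ j → f (a ↑ʳ j))
sum-+ zero    f = refl
sum-+ (suc a) f =
  trans (cong (f zero +_) (sum-+ a (f ∘ suc))) (sym (+-assoc (f zero) _ _))

sum-* : ∀ m {n} (f : Fin (m * n) → ℕ) →
  sum f ≡ sum {m} (λ i → sum {n} (λ j → f (combine i j)))
sum-* zero    f = refl
sum-* (suc m) {n} f =
  trans (sum-+ n f) (cong (sum (λ j → f (j ↑ˡ m * n)) +_) (sum-* m (λ j → f (n ↑ʳ j))))

-- Both sides carry an extra summand so that no subtraction occurs.
sum-update : ∀ {n} (i : Fin n) (x : ℕ) (f : Fin n → ℕ) →
  sum (λ j → if ⌊ i ≟ j ⌋ then x else f j) + f i ≡ x + sum f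
sum-update zero    x f = begin
  x + sum (f ∘ suc) + f zero   ≡⟨ +-assoc x _ _ ⟩
  x + (sum (f ∘ suc) + f zero) ≡⟨ cong (x +_) (+-comm _ (f zero)) ⟩
  x + (f zero + sum (f ∘ suc)) ∎
sum-update (suc i) x f = begin
  f zero + s + f (suc i)       ≡⟨ +-assoc (f zero) s _ ⟩
  f zero + (s + f (suc i))     ≡⟨ cong (f zero +_) (trans (cong (_+ f (suc i)) (sum-cong-≗ shift)) (sum-update i x (f ∘ suc))) ⟩
  f zero + (x + sum (f ∘ suc)) ≡⟨ rotate (f zero) x (sum (f ∘ suc)) ⟩
  x + (f zero + sum (f ∘ suc)) ∎
  where
  s = sum (λ j → if ⌊ suc i ≟ suc j ⌋ then x else f (suc j))
  shift : ∀ j → (if ⌊ suc i ≟ suc j ⌋ then x else f (suc j)) ≡ (if ⌊ i ≟ j ⌋ then x else f (suc j))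
  shift j with i ≟ j
  ... | yes _ = refl
  ... | no _  = refl
  rotate : ∀ a b c → a + (b + c) ≡ b + (a + c)
  rotate = solve-∀

≟-refl : ∀ {n} (i : Fin n) → ⌊ i ≟ i ⌋ ≡ true
≟-refl i with i ≟ i
... | yes _ = refl
... | no ¬p = contradiction refl ¬p

≟-≢ : ∀ {n} {i j : Fin n} → i ≢ j → ⌊ i ≟ j ⌋ ≡ false
≟-≢ {i = i} {j} i≢j with i ≟ j
... | yes p = contradiction p i≢j
... | no _  = refl

sum-single : ∀ {n} (i : Fin n) (f : Fin n → ℕ) →
  sum (λ j → if ⌊ i ≟ j ⌋ then f j else 0) ≡ f i
sum-single {n} i f = begin
  sum (λ j → if ⌊ i ≟ j ⌋ then f j else 0)     ≡⟨ sum-cong-≗ at-i ⟩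
  sum (λ j → if ⌊ i ≟ j ⌋ then f i else 0)     ≡⟨ +-identityʳ _ ⟨
  sum (λ j → if ⌊ i ≟ j ⌋ then f i else 0) + 0 ≡⟨ sum-update i (f i) (λ _ → 0) ⟩
  f i + sum {n} (λ _ → 0)                      ≡⟨ cong (f i +_) (trans (sum-const n 0) (*-zeroʳ n)) ⟩
  f i + 0                                      ≡⟨ +-identityʳ _ ⟩
  f i                                          ∎
  where
  at-i : ∀ j → (if ⌊ i ≟ j ⌋ then f j else 0) ≡ (if ⌊ i ≟ j ⌋ then f i else 0)
  at-i j with i ≟ j
  ... | yes refl = refl
  ... | no _     = refl

sum-one-point : ∀ {n} (i : Fin (suc n)) (x z : ℕ) →
  sum (λ j → if ⌊ i ≟ j ⌋ then x else z) ≡ x + n * z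
sum-one-point {n} i x z = +-cancelʳ-≡ z _ _ (begin
  sum (λ j → if ⌊ i ≟ j ⌋ then x else z) + z ≡⟨ sum-update i x (λ _ → z) ⟩
  x + sum {suc n} (λ _ → z)                  ≡⟨ cong (x +_) (sum-const (suc n) z) ⟩
  x + (z + n * z)                            ≡⟨ swap x z (n * z) ⟩
  x + n * z + z                              ∎)
  where
  swap : ∀ a b c → a + (b + c) ≡ a + c + b
  swap = solve-∀

sum-two-point : ∀ {n} {i j : Fin (suc (suc n))} (x y z : ℕ) → i ≢ j →
  sum (λ k → if ⌊ i ≟ k ⌋ then x else if ⌊ j ≟ k ⌋ then y else z) ≡ x + y + n * z
sum-two-point {n} {i} {j} x y z i≢j = +-cancelʳ-≡ z _ _ (begin
  s + z                     ≡⟨ cong (s +_) at-i ⟨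
  s + f i                   ≡⟨ sum-update i x f ⟩
  x + sum f                 ≡⟨ cong (x +_) (sum-one-point j y z) ⟩
  x + (y + (z + n * z))     ≡⟨ shuffle x y z (n * z) ⟩
  x + y + n * z + z         ∎)
  where
  f = λ k → if ⌊ j ≟ k ⌋ then y else z
  s = sum (λ k → if ⌊ i ≟ k ⌋ then x else f k)
  at-i : f i ≡ z
  at-i = cong (λ t → if t then y else z) (≟-≢ (i≢j ∘ sym))
  shuffle : ∀ a b c d → a + (b + (c + d)) ≡ a + b + d + c
  shuffle = solve-∀

-- Cardinalities of subsets and of their intersections

# : ∀ {n} → (Fin n → Bool) → ℕ
# p = sum (bit ∘ p)

sum-bool : ∀ {n} (f : Bool → ℕ) (p : Fin n → Bool) →
  sum (f ∘ p) ≡ # p * f true + # (not ∘ p) * f false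
sum-bool f p = begin
  sum (f ∘ p)                                                          ≡⟨ sum-cong-≗ (λ i → split (p i)) ⟩
  sum (λ i → bit (p i) * f true + bit (not (p i)) * f false)           ≡⟨ ∑-distrib-+ (λ i → bit (p i) * f true) _ ⟩
  sum (λ i → bit (p i) * f true) + sum (λ i → bit (not (p i)) * f false) ≡⟨ cong₂ _+_ (*-distribʳ-sum (f true) (bit ∘ p)) (*-distribʳ-sum (f false) (bit ∘ not ∘ p)) ⟨
  # p * f true + # (not ∘ p) * f false                                 ∎
  where
  split : ∀ b → f b ≡ bit b * f true + bit (not b) * f false
  split true  = sym (trans (+-identityʳ _) (+-identityʳ _))
  split false = sym (+-identityʳ _)

#-not : ∀ {n} (p : Fin n → Bool) → # p + # (not ∘ p) ≡ n
#-not {n} p = begin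
  # p + # (not ∘ p)         ≡⟨ cong₂ _+_ (*-identityʳ (# p)) (*-identityʳ (# (not ∘ p))) ⟨
  # p * 1 + # (not ∘ p) * 1 ≡⟨ sum-bool (λ _ → 1) p ⟨
  sum {n} (λ _ → 1)         ≡⟨ sum-const n 1 ⟩
  n * 1                     ≡⟨ *-identityʳ n ⟩
  n                         ∎

#-split : ∀ {n} (p q : Fin n → Bool) → # (λ i → p i ∧ q i) + # (λ i → p i ∧ not (q i)) ≡ # p
#-split p q = trans (sym (∑-distrib-+ (λ i → bit (p i ∧ q i)) _)) (sum-cong-≗ λ i → split (p i) (q i))
  where
  split : ∀ x y → bit (x ∧ y) + bit (x ∧ not y) ≡ bit x
  split true  true  = refl
  split true  false = refl
  split false _     = refl

#-∧-comm : ∀ {n} (p q : Fin n → Bool) → # (λ i → p i ∧ q i) ≡ # (λ i → q i ∧ p i)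
#-∧-comm p q = sum-cong-≗ λ i → cong bit (∧-comm (p i) (q i))

sum-bool₂ : ∀ {n} (f : Bool → Bool → ℕ) (p q : Fin n → Bool) →
  sum (λ i → f (p i) (q i)) ≡
    (# (λ i → p i ∧ q i) * f true true + # (λ i → p i ∧ not (q i)) * f true false) +
    (# (λ i → not (p i) ∧ q i) * f false true + # (λ i → not (p i) ∧ not (q i)) * f false false)
sum-bool₂ f p q = begin
  sum (λ i → f (p i) (q i))
    ≡⟨ sum-cong-≗ (λ i → split (p i) (q i)) ⟩
  sum (λ i → (tt i + tf i) + (ft i + ff i))
    ≡⟨ ∑-distrib-+ (λ i → tt i + tf i) _ ⟩
  sum (λ i → tt i + tf i) + sum (λ i → ft i + ff i)
    ≡⟨ cong₂ _+_ (∑-distrib-+ tt tf) (∑-distrib-+ ft ff) ⟩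
  (sum tt + sum tf) + (sum ft + sum ff)
    ≡⟨ cong₂ _+_ (cong₂ _+_ (*-distribʳ-sum (f true true) (λ i → bit (p i ∧ q i))) (*-distribʳ-sum (f true false) (λ i → bit (p i ∧ not (q i)))))
                 (cong₂ _+_ (*-distribʳ-sum (f false true) (λ i → bit (not (p i) ∧ q i))) (*-distribʳ-sum (f false false) (λ i → bit (not (p i) ∧ not (q i))))) ⟨
  _ ∎
  where
  tt = λ i → bit (p i ∧ q i) * f true true
  tf = λ i → bit (p i ∧ not (q i)) * f true false
  ft = λ i → bit (not (p i) ∧ q i) * f false true
  ff = λ i → bit (not (p i) ∧ not (q i)) * f false false
  split : ∀ x y → f x y ≡ (bit (x ∧ y) * f true true + bit (x ∧ not y) * f true false)
                        + (bit (not x ∧ y) * f false true + bit (not x ∧ not y) * f false false)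
  split true  true  = sym (trans (+-identityʳ _) (trans (+-identityʳ _) (+-identityʳ _)))
  split true  false = sym (trans (+-identityʳ _) (+-identityʳ _))
  split false true  = sym (trans (+-identityʳ _) (+-identityʳ _))
  split false false = sym (+-identityʳ _)

#-residual : ∀ {n} (p q : Fin n → Bool) → # (λ i → p i ∧ not (q i)) ≡ # p ∸ # (λ i → p i ∧ q i)
#-residual p q = sym (trans (cong (_∸ # (λ i → p i ∧ q i)) (sym (#-split p q))) (m+n∸m≡n (# (λ i → p i ∧ q i)) _))

#-complement : ∀ {n} (p : Fin n → Bool) → # (not ∘ p) ≡ n ∸ # p
#-complement p = sym (trans (cong (_∸ # p) (sym (#-not p))) (m+n∸m≡n (# p) _))

-- Two `k`-subsets meeting in `l` points cut the index set into cells of sizes l, k - l, k - l and n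
-- - k - (k - l); a sum that sees only membership in the two subsets is determined by these sizes.
sum-by-counts : ∀ {n} (f : Bool → Bool → ℕ) (p q : Fin n → Bool) {k l} →
  # p ≡ k → # q ≡ k → # (λ i → p i ∧ q i) ≡ l →
  sum (λ i → f (p i) (q i)) ≡
    (l * f true true + (k ∸ l) * f true false) +
    ((k ∸ l) * f false true + (n ∸ k ∸ (k ∸ l)) * f false false)
sum-by-counts {n} f p q refl #q refl = trans (sum-bool₂ f p q)
  (cong₂ _+_ (cong (λ t → # (λ i → p i ∧ q i) * f true true + t * f true false) (#-residual p q))
             (cong₂ (λ s t → s * f false true + t * f false false) ¬p∧q
               (trans (#-residual (not ∘ p) q) (cong₂ _∸_ (#-complement p) ¬p∧q))))
  where
  ¬p∧q : # (λ i → not (p i) ∧ q i) ≡ # p ∸ # (λ i → p i ∧ q i)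
  ¬p∧q = trans (#-∧-comm (not ∘ p) q)
    (trans (#-residual q p) (cong₂ _∸_ #q (#-∧-comm q p)))

find : ∀ {n} (p : Fin n → Bool) → 1 ≤ # p → ∃ λ i → p i ≡ true
find {suc n} p 1≤ with p zero in eq
... | true  = zero , eq
... | false with i , pi ← find (p ∘ suc) 1≤ = suc i , pi

bit-≤-# : ∀ {n} (p : Fin n → Bool) i → p i ≡ true → 1 ≤ # p
bit-≤-# p zero    pi rewrite pi = s≤s z≤n
bit-≤-# p (suc i) pi = m≤n⇒m≤o+n (bit (p zero)) (bit-≤-# (p ∘ suc) i pi)

-- Each summand is spread over the indicators of its colour pair and the summations are exchanged.
-- The sum thus depends on `c` and `d` only through the number of indices with each colour pair.
sum-by-colour : ∀ {n r} (h : Fin r → Fin r → ℕ) (c d : Fin n → Fin r) →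
  sum (λ w → h (c w) (d w)) ≡
  sum (λ i → sum (λ j → h i j * # (λ w → ⌊ c w ≟ i ⌋ ∧ ⌊ d w ≟ j ⌋)))
sum-by-colour h c d = begin
  sum (λ w → h (c w) (d w))
    ≡⟨ sum-cong-≗ (λ w → pick (c w) (d w)) ⟨
  sum (λ w → sum (λ i → sum (λ j → h i j * χ i j w)))
    ≡⟨ ∑-comm (λ w i → sum (λ j → h i j * χ i j w)) ⟩
  sum (λ i → sum (λ w → sum (λ j → h i j * χ i j w)))
    ≡⟨ sum-cong-≗ (λ i → ∑-comm (λ w j → h i j * χ i j w)) ⟩
  sum (λ i → sum (λ j → sum (λ w → h i j * χ i j w)))
    ≡⟨ sum-cong-≗ (λ i → sum-cong-≗ λ j → *-distribˡ-sum (h i j) (χ i j)) ⟨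
  sum (λ i → sum (λ j → h i j * sum (χ i j))) ∎
  where
  χ = λ i j w → bit (⌊ c w ≟ i ⌋ ∧ ⌊ d w ≟ j ⌋)
  pick₁ : ∀ {s} (b i : Fin s) (f : Fin s → ℕ) x →
    f i * bit (x ∧ ⌊ b ≟ i ⌋) ≡ (if ⌊ b ≟ i ⌋ then f i * bit x else 0)
  pick₁ b i f x with b ≟ i
  ... | yes _ = cong (λ t → f i * bit t) (∧-identityʳ x)
  ... | no  _ = trans (cong (λ t → f i * bit t) (∧-zeroʳ x)) (*-zeroʳ (f i))
  pick₂ : ∀ {s} (a i : Fin s) x → x * bit ⌊ a ≟ i ⌋ ≡ (if ⌊ a ≟ i ⌋ then x else 0)
  pick₂ a i x with a ≟ i
  ... | yes _ = *-identityʳ x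
  ... | no  _ = *-zeroʳ x
  pick : ∀ a b → sum (λ i → sum (λ j → h i j * bit (⌊ a ≟ i ⌋ ∧ ⌊ b ≟ j ⌋))) ≡ h a b
  pick a b = begin
    sum (λ i → sum (λ j → h i j * bit (⌊ a ≟ i ⌋ ∧ ⌊ b ≟ j ⌋)))
      ≡⟨ sum-cong-≗ (λ i → trans (sum-cong-≗ λ j → pick₁ b j (h i) ⌊ a ≟ i ⌋) (sum-single b (λ j → h i j * bit ⌊ a ≟ i ⌋))) ⟩
    sum (λ i → h i b * bit ⌊ a ≟ i ⌋)
      ≡⟨ sum-cong-≗ (λ i → pick₂ a i (h i b)) ⟩
    sum (λ i → if ⌊ a ≟ i ⌋ then h i b else 0)
      ≡⟨ sum-single a (λ i → h i b) ⟩
    h a b ∎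

-- Sums and counts over the vertices of a graph

sumV : (Γ : Graph) → (V Γ → ℕ) → ℕ
sumV Γ f = sum (λ i → f (vertex Γ i))

sumV-cong : ∀ Γ {f g : V Γ → ℕ} → (∀ w → f w ≡ g w) → sumV Γ f ≡ sumV Γ g
sumV-cong Γ f≗g = sum-cong-≗ λ i → f≗g (vertex Γ i)

numV-sum : ∀ Γ (p : V Γ → Bool) → numV Γ p ≡ sumV Γ (bit ∘ p)
numV-sum Γ p = count-sum (p ∘ vertex Γ)

-- The two enumerations differ by a permutation of indices.
sumV-reindex : ∀ Γ {N} (φ : Fin N ↔ V Γ) (f : V Γ → ℕ) →
  sumV Γ f ≡ sum (λ i → f (Inverse.to φ i))
sumV-reindex Γ φ f = trans (∑-permute (f ∘ vertex Γ) (↔-sym (enum Γ) ↔-∘ φ))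
  (sum-cong-≗ λ i → cong f (Inverse.strictlyInverseˡ (enum Γ) (Inverse.to φ i)))

numV-find : ∀ Γ (p : V Γ → Bool) → 1 ≤ numV Γ p → ∃ λ w → p w ≡ true
numV-find Γ p 1≤ with i , pi ← find (p ∘ vertex Γ) (subst (1 ≤_) (numV-sum Γ p) 1≤) = vertex Γ i , pi

numV-≥1 : ∀ Γ (p : V Γ → Bool) w → p w ≡ true → 1 ≤ numV Γ p
numV-≥1 Γ p w pw = subst (1 ≤_) (sym (numV-sum Γ p))
  (bit-≤-# (p ∘ vertex Γ) (Inverse.from (enum Γ) w)
    (trans (cong p (Inverse.strictlyInverseˡ (enum Γ) w)) pw))

-- Coherent configurations and lexicographic products of complete graphs

-- The intersection-number condition in linear form: `h` weights two-step paths by their colours.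
-- Indicators of colour pairs give back the intersection numbers, and edge indicators give numbers
-- of common neighbours.
IsPathCountInvariant : ∀ Γ {r} → (V Γ → V Γ → Fin r) → Set
IsPathCountInvariant Γ {r} c = ∀ (h : Fin r → Fin r → ℕ) {u v u′ v′} → c u v ≡ c u′ v′ →
  sumV Γ (λ w → h (c u w) (c w v)) ≡ sumV Γ (λ w → h (c u′ w) (c w v′))

⌊≟⌋-sound : ∀ {n} {i j : Fin n} → ⌊ i ≟ j ⌋ ≡ true → i ≡ j
⌊≟⌋-sound {i = i} {j} eq with i ≟ j
... | yes p = p

∧-true : ∀ {x y} → x ∧ y ≡ true → x ≡ true × y ≡ true
∧-true {true} {true} _ = refl , refl

common-sum : ∀ Γ u v → common Γ u v ≡ sumV Γ (λ w → bit (adj Γ u w ∧ adj Γ w v))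
common-sum Γ u v = numV-sum Γ (λ w → adj Γ u w ∧ adj Γ w v)

module _ (Γ : Graph) {r : ℕ} {c : V Γ → V Γ → Fin r} where

  via : Fin r → Fin r → V Γ → V Γ → V Γ → Bool
  via i j u v w = ⌊ c u w ≟ i ⌋ ∧ ⌊ c w v ≟ j ⌋

  invariant⇒intersection : IsPathCountInvariant Γ c →
    ∀ (i j : Fin r) u v u' v' → c u v ≡ c u' v' →
      numV Γ (via i j u v) ≡ numV Γ (via i j u' v')
  invariant⇒intersection inv i j u v u' v' eq =
    trans (numV-sum Γ (via i j u v))
      (trans (inv (λ a b → bit (⌊ a ≟ i ⌋ ∧ ⌊ b ≟ j ⌋)) eq) (sym (numV-sum Γ (via i j u' v'))))

  module _ (cc : IsCC Γ r c) where
    open IsCC cc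

    -- The weighted sum is a linear combination of intersection numbers with coefficients `h i j`.
    CC-invariant : IsPathCountInvariant Γ c
    CC-invariant h {u} {v} {u′} {v′} eq = begin
      sumV Γ (λ w → h (c u w) (c w v))
        ≡⟨ sum-by-colour h (c u ∘ vertex Γ) (λ w → c (vertex Γ w) v) ⟩
      sum (λ i → sum (λ j → h i j * # (via i j u v ∘ vertex Γ)))
        ≡⟨ sum-cong-≗ (λ i → sum-cong-≗ λ j → cong (h i j *_)
             (trans (sym (numV-sum Γ (via i j u v)))
               (trans (intersection i j u v u′ v′ eq) (numV-sum Γ (via i j u′ v′))))) ⟩
      sum (λ i → sum (λ j → h i j * # (via i j u′ v′ ∘ vertex Γ)))
        ≡⟨ sum-by-colour h (c u′ ∘ vertex Γ) (λ w → c (vertex Γ w) v′) ⟨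
      sumV Γ (λ w → h (c u′ w) (c w v′)) ∎

    -- The intersection number for the colours of the path through `w` is positive at (u, v), hence
    -- also at (u′, v′).
    path-lifting : ∀ {u v u′ v′} → c u v ≡ c u′ v′ → ∀ w →
      ∃ λ w′ → c u w ≡ c u′ w′ × c w v ≡ c w′ v′
    path-lifting {u} {v} {u′} {v′} eq w =
      let i = c u w ; j = c w v
          1≤ = numV-≥1 Γ (via i j u v) w (cong₂ _∧_ (≟-refl i) (≟-refl j))
          w′ , both = numV-find Γ (via i j u′ v′) (subst (1 ≤_) (intersection i j u v u′ v′ eq) 1≤)
          eq₁ , eq₂ = ∧-true both
      in w′ , sym (⌊≟⌋-sound eq₁) , sym (⌊≟⌋-sound eq₂)

    diagonal-invariant : ∀ {u v u′ v′} → c u v ≡ c u′ v′ → u ≡ v → u′ ≡ v′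
    diagonal-invariant {u} {u′ = u′} {v′} eq refl = diagonal u u′ v′ (sym eq)

    module _ (edges : EdgesUnion Γ r c) where

      common-invariant : ∀ {u v u′ v′} → c u v ≡ c u′ v′ → common Γ u v ≡ common Γ u′ v′
      common-invariant {u} {v} {u′} {v′} eq =
        trans (express u v) (trans (CC-invariant h eq) (sym (express u′ v′)))
        where
        -- Adjacency becomes a function of the colour by evaluating it at the representative pair
        -- that `nonempty` supplies.
        edge : Fin r → Bool
        edge i = adj Γ (proj₁ (nonempty i)) (proj₁ (proj₂ (nonempty i)))
        edge-c : ∀ u v → adj Γ u v ≡ edge (c u v)
        edge-c u v = edges u v _ _ (sym (proj₂ (proj₂ (nonempty (c u v)))))
        h : Fin r → Fin r → ℕ
        h i j = bit (edge i ∧ edge j)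
        express : ∀ u v → common Γ u v ≡ sumV Γ (λ w → h (c u w) (c w v))
        express u v = trans (common-sum Γ u v)
          (sumV-cong Γ λ w → cong₂ (λ x y → bit (x ∧ y)) (edge-c u w) (edge-c w v))

-- Path sums and coherence in the lexicographic product

sumV-Lex : ∀ m Γ (f : Fin m × V Γ → ℕ) →
  sumV (Lex (K m) Γ) f ≡ sum (λ q → sumV Γ (λ w → f (q , w)))
sumV-Lex m Γ f = trans (sum-* m _)
  (sum-cong-≗ λ q → sum-cong-≗ λ j →
    cong (λ (p , i) → f (p , vertex Γ i)) (remQuot-combine {m} q j))

sumV-const : ∀ Γ x → sumV Γ (λ _ → x) ≡ size Γ * x
sumV-const Γ x = sum-const (size Γ) x

-- Colour zero of the lexicographic product joins the different copies of Γ.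
lexColour : ∀ {m r} Γ → (V Γ → V Γ → Fin r) → Fin m × V Γ → Fin m × V Γ → Fin (suc r)
lexColour Γ c (p , x) (q , y) = if ⌊ p ≟ q ⌋ then suc (c x y) else zero

module _ {m r : ℕ} (Γ : Graph) (c : V Γ → V Γ → Fin r) where

  private
    c⁺ = lexColour {m} Γ c

  lexColour-≡ : ∀ p x y → c⁺ (p , x) (p , y) ≡ suc (c x y)
  lexColour-≡ p x y = cong (λ t → if t then suc (c x y) else zero) (≟-refl p)

  lexColour-≢ : ∀ {p q} x y → p ≢ q → c⁺ (p , x) (q , y) ≡ zero
  lexColour-≢ x y p≢q = cong (λ t → if t then suc (c x y) else zero) (≟-≢ p≢q)

  lexColour-suc : ∀ {p q x y i} → c⁺ (p , x) (q , y) ≡ suc i → p ≡ q × c x y ≡ i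
  lexColour-suc {p} {q} eq with p ≟ q
  ... | yes p≡q = p≡q , suc-injective eq
  lexColour-suc () | no _

  lexColour-zero : ∀ {p q x y} → c⁺ (p , x) (q , y) ≡ zero → p ≢ q
  lexColour-zero {p} {q} eq with p ≟ q
  lexColour-zero () | yes _
  ... | no p≢q = p≢q

module _ (m : ℕ) (Γ : Graph) {r : ℕ} (c : V Γ → V Γ → Fin r) where

  private
    L  = Lex (K (2 + m)) Γ
    c⁺ = lexColour {2 + m} Γ c

  -- A middle vertex in the common copy gives a path of Γ; in each of the `suc m` other copies both
  -- steps have colour zero.
  path-sum-same-copy : ∀ (h : Fin (suc r) → Fin (suc r) → ℕ) p x y →
    sumV L (λ w → h (c⁺ (p , x) w) (c⁺ w (p , y))) ≡
    sumV Γ (λ w → h (suc (c x w)) (suc (c w y))) + suc m * (size Γ * h zero zero)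
  path-sum-same-copy h p x y = begin
    sumV L (λ w → h (c⁺ (p , x) w) (c⁺ w (p , y)))
      ≡⟨ sumV-Lex (2 + m) Γ (λ w → h (c⁺ (p , x) w) (c⁺ w (p , y))) ⟩
    sum (λ q → sumV Γ (λ w → h (c⁺ (p , x) (q , w)) (c⁺ (q , w) (p , y))))
      ≡⟨ sum-cong-≗ by-copy ⟩
    sum (λ q → if ⌊ p ≟ q ⌋ then sumV Γ (λ w → h (suc (c x w)) (suc (c w y))) else size Γ * h zero zero)
      ≡⟨ sum-one-point p _ _ ⟩
    _ ∎
    where
    by-copy : ∀ q → sumV Γ (λ w → h (c⁺ (p , x) (q , w)) (c⁺ (q , w) (p , y))) ≡
      (if ⌊ p ≟ q ⌋ then sumV Γ (λ w → h (suc (c x w)) (suc (c w y))) else size Γ * h zero zero)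
    by-copy q with p ≟ q
    ... | yes refl = sumV-cong Γ λ w → cong (h (suc (c x w))) (lexColour-≡ Γ c p w y)
    ... | no p≢q   = trans (sumV-cong Γ λ w → cong (h zero) (lexColour-≢ Γ c w y (p≢q ∘ sym)))
                           (sumV-const Γ (h zero zero))

  -- The middle vertex lies in the copy of one end, where only one of the steps stays inside Γ, or
  -- in one of the `m` remaining copies.
  path-sum-other-copy : ∀ (h : Fin (suc r) → Fin (suc r) → ℕ) {p p′} x y → p ≢ p′ →
    sumV L (λ w → h (c⁺ (p , x) w) (c⁺ w (p′ , y))) ≡
    sumV Γ (λ w → h (suc (c x w)) zero) + sumV Γ (λ w → h zero (suc (c w y))) + m * (size Γ * h zero zero)
  path-sum-other-copy h {p} {p′} x y p≢p′ = begin
    sumV L (λ w → h (c⁺ (p , x) w) (c⁺ w (p′ , y)))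
      ≡⟨ sumV-Lex (2 + m) Γ (λ w → h (c⁺ (p , x) w) (c⁺ w (p′ , y))) ⟩
    sum (λ q → sumV Γ (λ w → h (c⁺ (p , x) (q , w)) (c⁺ (q , w) (p′ , y))))
      ≡⟨ sum-cong-≗ by-copy ⟩
    sum (λ q → if ⌊ p ≟ q ⌋ then sumV Γ (λ w → h (suc (c x w)) zero) else
               if ⌊ p′ ≟ q ⌋ then sumV Γ (λ w → h zero (suc (c w y))) else size Γ * h zero zero)
      ≡⟨ sum-two-point _ _ _ p≢p′ ⟩
    _ ∎
    where
    by-copy : ∀ q → sumV Γ (λ w → h (c⁺ (p , x) (q , w)) (c⁺ (q , w) (p′ , y))) ≡
      (if ⌊ p ≟ q ⌋ then sumV Γ (λ w → h (suc (c x w)) zero) else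
       if ⌊ p′ ≟ q ⌋ then sumV Γ (λ w → h zero (suc (c w y))) else size Γ * h zero zero)
    by-copy q with p ≟ q
    ... | yes refl = sumV-cong Γ λ w → cong (h (suc (c x w))) (lexColour-≢ Γ c w y p≢p′)
    ... | no p≢q with p′ ≟ q
    ...   | yes refl  = sumV-cong Γ λ w → cong (h zero) (lexColour-≡ Γ c p′ w y)
    ...   | no p′≢q   = trans (sumV-cong Γ λ w → cong (h zero) (lexColour-≢ Γ c w y (p′≢q ∘ sym)))
                              (sumV-const Γ (h zero zero))

  lexColour-invariant : IsPathCountInvariant Γ c → (∀ u v → c u u ≡ c v v) → IsPathCountInvariant L c⁺
  lexColour-invariant inv homogeneous h {p , x} {q , y} {p′ , x′} {q′ , y′} eq with p ≟ q | p′ ≟ q′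
  ... | yes refl | yes refl = begin
    _ ≡⟨ path-sum-same-copy h p x y ⟩
    _ ≡⟨ cong (_+ suc m * (size Γ * h zero zero)) (inv (λ i j → h (suc i) (suc j)) (suc-injective eq)) ⟩
    _ ≡⟨ path-sum-same-copy h p′ x′ y′ ⟨
    _ ∎
  ... | no p≢q | no p′≢q′ = begin
    _ ≡⟨ path-sum-other-copy h x y p≢q ⟩
    _ ≡⟨ cong₂ (λ s t → s + t + m * (size Γ * h zero zero))
           -- A row sum at `x` is a sum over closed paths from `x` to `x` with a weight that ignores
           -- the second step, so homogeneity carries it to `x′`.
           (inv (λ i _ → h (suc i) zero) (homogeneous x x′))
           (inv (λ _ j → h zero (suc j)) (homogeneous y y′)) ⟩
    _ ≡⟨ path-sum-other-copy h x′ y′ p′≢q′ ⟨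
    _ ∎

  lexColour-CC : IsCC Γ r c → (∀ u v → c u u ≡ c v v) → V Γ → IsCC L (suc r) c⁺
  lexColour-CC cc homogeneous x₀ = record
    { nonempty = λ where
        zero    → (zero , x₀) , (suc zero , x₀) , refl
        (suc i) → let (x , y , eq) = nonempty i in (zero , x) , (zero , y) , cong suc eq
    ; diagonal = λ (p , x) (q , y) (q′ , z) eq →
        let (q≡q′ , eq′) = lexColour-suc Γ c (trans eq (lexColour-≡ Γ c p x x))
        in cong₂ _,_ q≡q′ (diagonal x y z eq′)
    ; transpose = transpose⁺
    ; intersection = invariant⇒intersection L
        (lexColour-invariant (CC-invariant Γ cc) homogeneous)
    }
    where
    open IsCC cc
    transpose⁺ : ∀ u v u' v' → c⁺ u v ≡ c⁺ u' v' → c⁺ v u ≡ c⁺ v' u'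
    transpose⁺ (p , x) (q , y) (p′ , x′) (q′ , y′) eq with p ≟ q | p′ ≟ q′
    ... | yes refl | yes refl =
      trans (lexColour-≡ Γ c p y x) (trans (cong suc (transpose x y x′ y′ (suc-injective eq))) (sym (lexColour-≡ Γ c p′ y′ x′)))
    ... | no p≢q | no p′≢q′ = trans (lexColour-≢ Γ c y x (p≢q ∘ sym)) (sym (lexColour-≢ Γ c y′ x′ (p′≢q′ ∘ sym)))

-- Colours: equality, same clique, edge between the cliques, non-edge between the cliques.
cliqueEdge : Fin 4 → Bool
cliqueEdge 0F = false
cliqueEdge 1F = true
cliqueEdge 2F = true
cliqueEdge 3F = false

-- The common neighbours of a vertex with itself are all its neighbours, so `d` is the degree.
commonCount : (d a b : ℕ) → Fin 4 → ℕ
commonCount d a b 0F = d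
commonCount d a b 1F = a
commonCount d a b 2F = b
commonCount d a b 3F = a

-- Vertices in different copies share the `d` neighbours of each end in its own copy and every
-- vertex of the remaining copies; `d+d` makes this total equal to the one for a cross edge. The
-- field `separated` distinguishes these two relations nevertheless.
record CliqueScheme (Γ : Graph) (d a b : ℕ) : Set where
  field
    colour     : V Γ → V Γ → Fin 4
    coherent   : IsCC Γ 4 colour
    reflexive  : ∀ u → colour u u ≡ 0F
    symmetric  : ∀ u v → colour u v ≡ colour v u
    adj-colour : ∀ u v → adj Γ u v ≡ cliqueEdge (colour u v)
    common-colour : ∀ u v → common Γ u v ≡ commonCount d a b (colour u v)
    a≢b        : a ≢ b
    d+d        : d + d ≡ size Γ + b
    separated  : ∀ {u v} → colour u v ≡ 2F → ∃ λ w → colour u w ≡ 1F × colour w v ≡ 3F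

-- Deza property, diameter and WL-rank of the product

module LexCliqueScheme (m : ℕ) {Γ : Graph} {d a b : ℕ} (scheme : CliqueScheme Γ d a b) where
  open CliqueScheme scheme
  open IsCC coherent

  L : Graph
  L = Lex (K (2 + m)) Γ

  -- The colours of Γ move up by one: 0F different copies, 1F equality, 2F same clique, 3F cross
  -- edge, 4F cross non-edge.
  colour⁺ : V L → V L → Fin 5
  colour⁺ = lexColour Γ colour

  coherent⁺ : IsCC L 5 colour⁺
  coherent⁺ = lexColour-CC m Γ colour coherent
    (λ u v → trans (reflexive u) (sym (reflexive v))) (proj₁ (nonempty 0F))

  reflexive⁺ : ∀ u → colour⁺ u u ≡ 1F
  reflexive⁺ (p , x) = trans (lexColour-≡ Γ colour p x x) (cong suc (reflexive x))

  diagonal⁺ : ∀ {u v} → colour⁺ u v ≡ 1F → u ≡ v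
  diagonal⁺ {u} {v} eq = IsCC.diagonal coherent⁺ u u v (trans eq (sym (reflexive⁺ u)))

  edge⁺ : Fin 5 → Bool
  edge⁺ zero    = true
  edge⁺ (suc i) = cliqueEdge i

  adj⁺ : ∀ u v → adj L u v ≡ edge⁺ (colour⁺ u v)
  adj⁺ (p , x) (q , y) with p ≟ q
  ... | yes _ = adj-colour x y
  ... | no _  = refl

  -- The vertices of the other copies are common neighbours of any pair within one copy. The factor
  -- 1 is the weight `h zero zero` left by the path sums.
  outside : ℕ
  outside = suc m * (size Γ * 1)

  common⁺-count : Fin 5 → ℕ
  common⁺-count zero    = b + outside
  common⁺-count (suc i) = commonCount d a b i + outside

  private
    -- By symmetry the common neighbours of `x` with itself are its neighbours. The conjunct `true`
    -- is the edge value of colour zero, in the shape in which the path sums to another copy produce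
    -- it.
    degree-sum : ∀ x → sumV Γ (λ w → bit (cliqueEdge (colour x w) ∧ true)) ≡ d
    degree-sum x = begin
      sumV Γ (λ w → bit (cliqueEdge (colour x w) ∧ true))
        ≡⟨ sumV-cong Γ (λ w → cong bit (flip w)) ⟨
      sumV Γ (λ w → bit (adj Γ x w ∧ adj Γ w x))
        ≡⟨ common-sum Γ x x ⟨
      common Γ x x
        ≡⟨ trans (common-colour x x) (cong (commonCount d a b) (reflexive x)) ⟩
      d ∎
      where
      flip : ∀ w → adj Γ x w ∧ adj Γ w x ≡ cliqueEdge (colour x w) ∧ true
      flip w = begin
        adj Γ x w ∧ adj Γ w x ≡⟨ cong₂ _∧_ (adj-colour x w) (trans (adj-colour w x) (cong cliqueEdge (symmetric w x))) ⟩
        xw ∧ xw               ≡⟨ ∧-idem xw ⟩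
        xw                    ≡⟨ ∧-identityʳ xw ⟨
        xw ∧ true             ∎
        where xw = cliqueEdge (colour x w)

    edges₂ : Fin 5 → Fin 5 → ℕ
    edges₂ i j = bit (edge⁺ i ∧ edge⁺ j)

    common⁺-sum : ∀ u v → common L u v ≡ sumV L (λ w → edges₂ (colour⁺ u w) (colour⁺ w v))
    common⁺-sum u v = trans (common-sum L u v)
      (sumV-cong L λ w → cong₂ (λ s t → bit (s ∧ t)) (adj⁺ u w) (adj⁺ w v))

  common⁺ : ∀ u v → common L u v ≡ common⁺-count (colour⁺ u v)
  common⁺ (p , x) (q , y) with p ≟ q
  ... | yes refl = begin
    common L (p , x) (p , y)
      ≡⟨ trans (common⁺-sum (p , x) (p , y)) (path-sum-same-copy m Γ colour edges₂ p x y) ⟩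
    sumV Γ (λ w → bit (cliqueEdge (colour x w) ∧ cliqueEdge (colour w y))) + outside
      ≡⟨ cong (_+ outside) (trans (sumV-cong Γ λ w → cong₂ (λ s t → bit (s ∧ t)) (sym (adj-colour x w)) (sym (adj-colour w y))) (sym (common-sum Γ x y))) ⟩
    common Γ x y + outside
      ≡⟨ cong (_+ outside) (common-colour x y) ⟩
    _ ∎
  ... | no p≢q = begin
    common L (p , x) (q , y)
      ≡⟨ trans (common⁺-sum (p , x) (q , y)) (path-sum-other-copy m Γ colour edges₂ x y p≢q) ⟩
    sumV Γ (λ w → bit (cliqueEdge (colour x w) ∧ true)) + sumV Γ (λ w → bit (cliqueEdge (colour w y))) + m * (size Γ * 1)
      ≡⟨ cong₂ (λ s t → s + t + m * (size Γ * 1)) (degree-sum x)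
           (trans (sumV-cong Γ λ w → cong bit (trans (cong cliqueEdge (symmetric w y)) (sym (∧-identityʳ _)))) (degree-sum y)) ⟩
    d + d + m * (size Γ * 1)
      ≡⟨ cong (_+ m * (size Γ * 1)) d+d ⟩
    size Γ + b + m * (size Γ * 1)
      ≡⟨ rearrange (size Γ) b (m * (size Γ * 1)) ⟩
    b + outside ∎
    where
    rearrange : ∀ s b t → s + b + t ≡ b + (s * 1 + t)
    rearrange = solve-∀

  regular⁺ : Regular L (d + outside)
  regular⁺ u@(p , x) = begin
    degree L u                            ≡⟨ numV-sum L (adj L u) ⟩
    sumV L (λ w → bit (adj L u w))        ≡⟨ sumV-cong L (λ w → cong bit (trans (adj⁺ u w) (sym (∧-identityʳ _)))) ⟩
    sumV L (λ w → bit (edge⁺ (colour⁺ u w) ∧ true)) ≡⟨ path-sum-same-copy m Γ colour (λ i _ → bit (edge⁺ i ∧ true)) p x x ⟩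
    sumV Γ (λ w → bit (cliqueEdge (colour x w) ∧ true)) + outside ≡⟨ cong (_+ outside) (degree-sum x) ⟩
    d + outside ∎

  deza : IsDeza L
  deza = d + outside , regular⁺ , a + outside , b + outside , λ u v u≢v →
    two-values u v (u≢v ∘ diagonal⁺) (common⁺ u v)
    where
    two-values : ∀ u v → colour⁺ u v ≢ 1F → common L u v ≡ common⁺-count (colour⁺ u v) →
      common L u v ≡ a + outside ⊎ common L u v ≡ b + outside
    two-values u v ≢1 eq with colour⁺ u v
    ... | 0F = inj₂ eq
    ... | 1F = contradiction refl ≢1
    ... | 2F = inj₁ eq
    ... | 3F = inj₂ eq
    ... | 4F = inj₁ eq

  private
    coloured : ∀ i → Σ (V L) λ u → Σ (V L) λ v → colour⁺ u v ≡ i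
    coloured = IsCC.nonempty coherent⁺

    distinct : ∀ {u v i} → colour⁺ u v ≡ i → i ≢ 1F → u ≢ v
    distinct {u} eq i≢1 refl = i≢1 (trans (sym eq) (reflexive⁺ u))

  not-SRG : ¬ IsSRG L
  not-SRG (_ , _ , l , _ , adjacent , _) =
    a≢b (+-cancelʳ-≡ outside a b (trans (sym (edge-value (coloured 2F) refl λ ())) (edge-value (coloured 3F) refl λ ())))
    where
    edge-value : ∀ {i} → (Σ (V L) λ u → Σ (V L) λ v → colour⁺ u v ≡ i) → edge⁺ i ≡ true → i ≢ 1F →
      l ≡ common⁺-count i
    edge-value (u , v , refl) edge i≢1 =
      trans (sym (adjacent u v (distinct refl i≢1) (trans (adj⁺ u v) edge))) (common⁺ u v)

  another-copy : (p : Fin (2 + m)) → ∃ λ q → p ≢ q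
  another-copy zero    = suc zero , λ ()
  another-copy (suc p) = zero , λ ()

  -- Any vertex of a second copy is adjacent to both ends of a pair in one copy, and a cross
  -- non-edge is a pair of distinct non-adjacent vertices.
  diameter-2 : Diameter2 L
  diameter-2 = close , far
    where
    close : ∀ u v → Dist≤2 L u v
    close (p , x) (q , y) with p ≟ q
    ... | no _     = inj₂ (inj₁ refl)
    ... | yes refl with r , p≢r ← another-copy p =
      inj₂ (inj₂ ((r , x) , joined {x = x} {x} p≢r , joined {x = x} {y} (p≢r ∘ sym)))
      where
      joined : ∀ {p q x y} → p ≢ q → Adj L (p , x) (q , y)
      joined {p} {q} {x} {y} p≢q =
        trans (adj⁺ (p , x) (q , y)) (cong edge⁺ (lexColour-≢ Γ colour x y p≢q))
    far : Σ (V L) λ u → Σ (V L) λ v → u ≢ v × ¬ Adj L u v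
    far with u , v , eq ← coloured 4F = u , v , distinct eq (λ ()) , λ uv →
      case trans (sym uv) (trans (adj⁺ u v) (cong edge⁺ eq)) of λ ()

  strictlyDeza : IsStrictlyDeza L
  strictlyDeza = deza , not-SRG , diameter-2

  edges-union : EdgesUnion L 5 colour⁺
  edges-union u v u′ v′ eq = trans (adj⁺ u v) (trans (cong edge⁺ eq) (sym (adj⁺ u′ v′)))

  -- Adjacency and common neighbour numbers leave two ambiguities. Since `d` may equal `a`, 1F and
  -- 4F are told apart by equality; 0F and 3F agree in all of these and are excluded by the last two
  -- hypotheses.
  colour-determined : ∀ i j → edge⁺ i ≡ edge⁺ j → common⁺-count i ≡ common⁺-count j →
    (i ≡ 1F → j ≡ 1F) → (j ≡ 1F → i ≡ 1F) →
    ¬ (i ≡ 3F × j ≡ 0F) → ¬ (i ≡ 0F × j ≡ 3F) → i ≡ j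
  colour-determined 0F 0F _ _ _ _ _ _ = refl
  colour-determined 0F 2F _ κ _ _ _ _ = contradiction (sym (+-cancelʳ-≡ outside b a κ)) a≢b
  colour-determined 0F 3F _ _ _ _ _ n = contradiction (refl , refl) n
  colour-determined 0F 4F ()
  colour-determined 1F 1F _ _ _ _ _ _ = refl
  colour-determined 1F 4F _ _ f _ _ _ = sym (f refl)
  colour-determined 2F 0F _ κ _ _ _ _ = contradiction (+-cancelʳ-≡ outside a b κ) a≢b
  colour-determined 2F 2F _ _ _ _ _ _ = refl
  colour-determined 2F 3F _ κ _ _ _ _ = contradiction (+-cancelʳ-≡ outside a b κ) a≢b
  colour-determined 2F 4F ()
  colour-determined 3F 0F _ _ _ _ n _ = contradiction (refl , refl) n
  colour-determined 3F 2F _ κ _ _ _ _ = contradiction (sym (+-cancelʳ-≡ outside b a κ)) a≢b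
  colour-determined 3F 3F _ _ _ _ _ _ = refl
  colour-determined 3F 4F ()
  colour-determined 4F 1F _ _ _ g _ _ = g refl
  colour-determined 4F 4F _ _ _ _ _ _ = refl

  -- This is the minimality of `colour⁺`: every invariant that `colour-determined` consults is
  -- constant on the classes of `c`.
  refines-colour⁺ : ∀ r (c : V L → V L → Fin r) → IsCC L r c → EdgesUnion L r c → Refines L r 5 c colour⁺
  refines-colour⁺ r c cc edges u v u′ v′ eq = colour-determined (colour⁺ u v) (colour⁺ u′ v′)
    (measure-edge eq) (measure-common eq)
    (measure-diagonal eq) (measure-diagonal (sym eq))
    (λ (i , j) → separate eq i j) (λ (i , j) → separate (sym eq) j i)
    where
    measure-edge : ∀ {u v u′ v′} → c u v ≡ c u′ v′ → edge⁺ (colour⁺ u v) ≡ edge⁺ (colour⁺ u′ v′)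
    measure-edge {u} {v} {u′} {v′} eq = trans (sym (adj⁺ u v)) (trans (edges u v u′ v′ eq) (adj⁺ u′ v′))
    measure-common : ∀ {u v u′ v′} → c u v ≡ c u′ v′ →
      common⁺-count (colour⁺ u v) ≡ common⁺-count (colour⁺ u′ v′)
    measure-common {u} {v} {u′} {v′} eq =
      trans (sym (common⁺ u v)) (trans (common-invariant L cc edges eq) (common⁺ u′ v′))
    measure-diagonal : ∀ {u v u′ v′} → c u v ≡ c u′ v′ → colour⁺ u v ≡ 1F → colour⁺ u′ v′ ≡ 1F
    measure-diagonal {u′ = u′} eq i =
      subst (λ w → colour⁺ u′ w ≡ 1F) (diagonal-invariant L cc eq (diagonal⁺ i)) (reflexive⁺ u′)
    -- The clique of u contains a non-neighbour of v when u and v lie in the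
    -- same copy of Γ, but not when they lie in different copies.
    separate : ∀ {u v u′ v′} → c u v ≡ c u′ v′ → colour⁺ u v ≡ 3F → colour⁺ u′ v′ ≡ 0F → ⊥
    separate {p , x} {q , y} {p′ , x′} {q′ , y′} eq i j
      with refl , i′ ← lexColour-suc Γ colour {p = p} {q} i
      with z , xz , zy ← separated i′
      -- The lifted path has the same adjacencies and common neighbour numbers. Its first step
      -- forces `r ≡ p′` as a clique edge, its second forces `r ≡ q′` as a non-edge, against the
      -- ends lying in different copies.
      with (r , z′) , e₁ , e₂ ← path-lifting L cc eq (p , z)
      = lexColour-zero Γ colour j (trans (same-clique xz⁺) (non-adjacent zy⁺))
      where
      -- The other two edge colours have `b` in place of `a`.
      clique-key : ∀ i → edge⁺ i ≡ true → common⁺-count i ≡ a + outside → i ≡ 2F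
      clique-key 0F _ κ = contradiction (sym (+-cancelʳ-≡ outside b a κ)) a≢b
      clique-key 2F _ _ = refl
      clique-key 3F _ κ = contradiction (sym (+-cancelʳ-≡ outside b a κ)) a≢b
      clique-key 4F ()
      xz⁺ : colour⁺ (p′ , x′) (r , z′) ≡ 2F
      xz⁺ = clique-key _
        (trans (sym (measure-edge e₁)) (cong edge⁺ xz₀)) (trans (sym (measure-common e₁)) (cong common⁺-count xz₀))
        where xz₀ = trans (lexColour-≡ Γ colour p x z) (cong suc xz)
      zy⁺ : edge⁺ (colour⁺ (r , z′) (q′ , y′)) ≡ false
      zy⁺ = trans (sym (measure-edge e₂)) (cong edge⁺ (trans (lexColour-≡ Γ colour p z y) (cong suc zy)))
      same-clique : ∀ {p q x y} → colour⁺ (p , x) (q , y) ≡ 2F → p ≡ q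
      same-clique eq = proj₁ (lexColour-suc Γ colour eq)
      non-adjacent : ∀ {p q x y} → edge⁺ (colour⁺ (p , x) (q , y)) ≡ false → p ≡ q
      non-adjacent {p} {q} _ with p ≟ q
      ... | yes p≡q = p≡q
      non-adjacent () | no _

  rank-5 : WLRank L 5
  rank-5 = colour⁺ , coherent⁺ , edges-union , refines-colour⁺

-- Two cliques joined along a symmetric design

sameSide : Bool → Fin 4
sameSide true  = 0F
sameSide false = 1F

oppositeSide : Bool → Fin 4
oppositeSide true  = 2F
oppositeSide false = 3F

-- M is the incidence matrix of a symmetric design with n = 2 + n′ points and
-- blocks of size k = suc k′, any two of which meet in l points.
module TwoCliques {n′ k′ l : ℕ} (M : Fin (2 + n′) → Fin (2 + n′) → Bool)
  (M-sym : ∀ i j → M i j ≡ M j i)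
  (row : ∀ i → # (M i) ≡ suc k′)
  (pair : ∀ i j → i ≢ j → # (λ t → M i t ∧ M t j) ≡ l)
  (k<n : suc k′ < 2 + n′)
  (k+k≡n′+l : suc k′ + suc k′ ≡ n′ + l)
  where

  private
    n k : ℕ
    n = 2 + n′
    k = suc k′

  column : ∀ j → # (λ i → M i j) ≡ k
  column j = trans (sum-cong-≗ λ i → cong bit (M-sym i j)) (row j)

  same cross : Fin n → Fin n → Fin 4
  same i j  = sameSide ⌊ i ≟ j ⌋
  cross i j = oppositeSide (M i j)

  colour : Fin n × Fin 2 → Fin n × Fin 2 → Fin 4
  colour (i , 0F) (j , 0F) = same i j
  colour (i , 1F) (j , 1F) = same i j
  colour (i , 0F) (j , 1F) = cross i j
  colour (i , 1F) (j , 0F) = cross i j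

  ≟-sym : (i j : Fin n) → ⌊ i ≟ j ⌋ ≡ ⌊ j ≟ i ⌋
  ≟-sym i j with i ≟ j
  ... | yes refl = sym (≟-refl i)
  ... | no i≢j   = sym (≟-≢ (i≢j ∘ sym))

  colour-sym : ∀ u v → colour u v ≡ colour v u
  colour-sym (i , 0F) (j , 0F) = cong sameSide (≟-sym i j)
  colour-sym (i , 1F) (j , 1F) = cong sameSide (≟-sym i j)
  colour-sym (i , 0F) (j , 1F) = cong oppositeSide (M-sym i j)
  colour-sym (i , 1F) (j , 0F) = cong oppositeSide (M-sym i j)

  colour-refl : ∀ u → colour u u ≡ 0F
  colour-refl (i , 0F) = cong sameSide (≟-refl i)
  colour-refl (i , 1F) = cong sameSide (≟-refl i)

  private
    same-0F : ∀ {i j} → same i j ≡ 0F → i ≡ j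
    same-0F {i} {j} eq with i ≟ j
    ... | yes i≡j = i≡j

    same-≢2F : ∀ {i j} → same i j ≢ 2F
    same-≢2F {i} {j} eq with i ≟ j
    same-≢2F () | yes _
    same-≢2F () | no _

    cross-≢0F : ∀ {i j} → cross i j ≢ 0F
    cross-≢0F {i} {j} eq with M i j
    cross-≢0F () | true
    cross-≢0F () | false

    cross-2F : ∀ {i j} → cross i j ≡ 2F → M i j ≡ true
    cross-2F {i} {j} eq with M i j
    ... | true = refl

  colour-0F : ∀ u v → colour u v ≡ 0F → u ≡ v
  colour-0F (i , 0F) (j , 0F) eq = cong (_, 0F) (same-0F eq)
  colour-0F (i , 1F) (j , 1F) eq = cong (_, 1F) (same-0F eq)
  colour-0F (i , 0F) (j , 1F) eq = contradiction eq cross-≢0F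
  colour-0F (i , 1F) (j , 0F) eq = contradiction eq cross-≢0F

  -- A column has n - k zeros, a positive number by `k<n`.
  column-gap : ∀ j → ∃ λ i → M i j ≡ false
  column-gap j =
    let i , eq = find (λ i → not (M i j))
          (subst (1 ≤_) (sym (trans (#-complement (λ i → M i j)) (cong (n ∸_) (column j)))) (m<n⇒0<n∸m k<n))
    in i , not-injective eq

  -- The witness is a zero of the column of `v`, placed in the clique of `u`. It differs from `u`
  -- because the entry at `u` is a one.
  colour-separated : ∀ {u v} → colour u v ≡ 2F → ∃ λ w → colour u w ≡ 1F × colour w v ≡ 3F
  colour-separated {i , s} {j , t} eq with column-gap j
  ... | l , gap = separate s t eq
    where
    i≢l : cross i j ≡ 2F → i ≢ l
    i≢l eq refl = case trans (sym gap) (cross-2F eq) of λ ()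
    separate : ∀ s t → colour (i , s) (j , t) ≡ 2F →
      ∃ λ w → colour (i , s) w ≡ 1F × colour w (j , t) ≡ 3F
    separate 0F 0F eq = contradiction eq same-≢2F
    separate 1F 1F eq = contradiction eq same-≢2F
    separate 0F 1F eq = (l , 0F) , cong sameSide (≟-≢ (i≢l eq)) , cong oppositeSide gap
    separate 1F 0F eq = (l , 1F) , cong sameSide (≟-≢ (i≢l eq)) , cong oppositeSide gap

  -- Closed forms for path sums, depending on the colour of the ends only

  module PathSums (h : Fin 4 → Fin 4 → ℕ) where

    -- Paths through the opposite clique, for two blocks meeting in `l` points. A block meets itself
    -- in all `k` points, hence `crossValue k` for equal ends.
    crossValue : ℕ → ℕ
    crossValue l =
      (l * h 2F 2F + (k ∸ l) * h 2F 3F) + ((k ∸ l) * h 3F 2F + (n ∸ k ∸ (k ∸ l)) * h 3F 3F)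

    -- In the clique of an end, that end contributes a term with 0F instead of the term with 1F that
    -- the full row or column sum assigns to it. The term subtracted is one of the summands, so
    -- truncation does no harm.
    mixedValue : Fin 4 → ℕ
    mixedValue x =
      (h 0F x + (k * h 1F 2F + (n ∸ k) * h 1F 3F) ∸ h 1F x) +
      (h x 0F + (k * h 2F 1F + (n ∸ k) * h 3F 1F) ∸ h x 1F)

    pathValue : Fin 4 → ℕ
    pathValue 0F = h 0F 0F + suc n′ * h 1F 1F + crossValue k
    pathValue 1F = h 0F 1F + h 1F 0F + n′ * h 1F 1F + crossValue l
    pathValue 2F = mixedValue 2F
    pathValue 3F = mixedValue 3F

    private
      f : Bool → Bool → ℕ
      f x y = h (oppositeSide x) (oppositeSide y)

    same-then-same : ∀ i j → sum (λ t → h (same i t) (same t j)) + sum (λ t → h (cross i t) (cross t j)) ≡ pathValue (same i j)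
    same-then-same i j with i ≟ j
    ... | yes refl = cong₂ _+_
      (trans (sum-cong-≗ at) (sum-one-point i _ _))
      (sum-by-counts f (M i) (λ t → M t i) (row i) (column i)
        (trans (sum-cong-≗ λ t → cong bit (trans (cong (M i t ∧_) (M-sym t i)) (∧-idem (M i t)))) (row i)))
      where
      at : ∀ t → h (same i t) (same t i) ≡ (if ⌊ i ≟ t ⌋ then h 0F 0F else h 1F 1F)
      at t with i ≟ t
      ... | yes refl = cong (λ b → h 0F (sameSide b)) (≟-refl i)
      ... | no i≢t   = cong (λ b → h 1F (sameSide b)) (≟-≢ (i≢t ∘ sym))
    ... | no i≢j = cong₂ _+_
      (trans (sum-cong-≗ at) (sum-two-point _ _ _ i≢j))
      (sum-by-counts f (M i) (λ t → M t j) (row i) (column j) (pair i j i≢j))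
      where
      at : ∀ t → h (same i t) (same t j) ≡
        (if ⌊ i ≟ t ⌋ then h 0F 1F else if ⌊ j ≟ t ⌋ then h 1F 0F else h 1F 1F)
      at t with i ≟ t
      ... | yes refl = cong (λ b → h 0F (sameSide b)) (≟-≢ i≢j)
      ... | no _ with j ≟ t
      ...   | yes refl = cong (λ b → h 1F (sameSide b)) (≟-refl j)
      ...   | no j≢t   = cong (λ b → h 1F (sameSide b)) (≟-≢ (j≢t ∘ sym))

    private
      update-∸ : ∀ (i : Fin n) x (g g′ : Fin n → ℕ) →
        (∀ t → g t ≡ (if ⌊ i ≟ t ⌋ then x else g′ t)) → sum g ≡ x + sum g′ ∸ g′ i
      update-∸ i x g g′ g≗ = begin
        sum g                                               ≡⟨ sum-cong-≗ g≗ ⟩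
        sum (λ t → if ⌊ i ≟ t ⌋ then x else g′ t)           ≡⟨ m+n∸n≡m _ (g′ i) ⟨
        sum (λ t → if ⌊ i ≟ t ⌋ then x else g′ t) + g′ i ∸ g′ i ≡⟨ cong (_∸ g′ i) (sum-update i x g′) ⟩
        x + sum g′ ∸ g′ i                                   ∎

      sum-by-count : ∀ (g : Bool → ℕ) (p : Fin n → Bool) → # p ≡ k →
        sum (g ∘ p) ≡ k * g true + (n ∸ k) * g false
      sum-by-count g p eq = trans (sum-bool g p)
        (cong₂ (λ s t → s * g true + t * g false) eq (trans (#-complement p) (cong (n ∸_) eq)))

    mixed : ∀ i j → sum (λ t → h (same i t) (cross t j)) + sum (λ t → h (cross i t) (same t j)) ≡ pathValue (cross i j)
    mixed i j = trans (cong₂ _+_ first second) (value (M i j))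
      where
      first : sum (λ t → h (same i t) (cross t j)) ≡
        h 0F (cross i j) + (k * h 1F 2F + (n ∸ k) * h 1F 3F) ∸ h 1F (cross i j)
      first = trans (update-∸ i _ _ (λ t → h 1F (cross t j)) at)
        (cong (λ s → h 0F (cross i j) + s ∸ h 1F (cross i j))
          (sum-by-count (h 1F ∘ oppositeSide) (λ t → M t j) (column j)))
        where
        at : ∀ t → h (same i t) (cross t j) ≡ (if ⌊ i ≟ t ⌋ then h 0F (cross i j) else h 1F (cross t j))
        at t with i ≟ t
        ... | yes refl = refl
        ... | no _     = refl
      second : sum (λ t → h (cross i t) (same t j)) ≡
        h (cross i j) 0F + (k * h 2F 1F + (n ∸ k) * h 3F 1F) ∸ h (cross i j) 1F
      second = trans (update-∸ j _ _ (λ t → h (cross i t) 1F) at)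
        (cong (λ s → h (cross i j) 0F + s ∸ h (cross i j) 1F)
          (sum-by-count (λ b → h (oppositeSide b) 1F) (M i) (row i)))
        where
        at : ∀ t → h (cross i t) (same t j) ≡ (if ⌊ j ≟ t ⌋ then h (cross i j) 0F else h (cross i t) 1F)
        at t with j ≟ t
        ... | yes refl = cong (λ b → h (cross i j) (sameSide b)) (≟-refl j)
        ... | no j≢t   = cong (λ b → h (cross i t) (sameSide b)) (≟-≢ (j≢t ∘ sym))
      value : ∀ b → mixedValue (oppositeSide b) ≡ pathValue (oppositeSide b)
      value true  = refl
      value false = refl

  -- Enumeration, equality test and adjacency are parameters, so that the scheme applies to Γ(D) and
  -- to K₄ × K₂ as they are given.
  module _ (enumeration : Fin (n * 2) ↔ (Fin n × Fin 2)) (_≟₂_ : DecidableEquality (Fin n × Fin 2))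
    (edge : Fin n × Fin 2 → Fin n × Fin 2 → Bool)
    (edge-colour : ∀ u v → edge u v ≡ cliqueEdge (colour u v)) where

    Γ : Graph
    Γ = record { V = Fin n × Fin 2 ; size = n * 2 ; enum = enumeration ; _≟V_ = _≟₂_ ; adj = edge }

    sumV-sides : ∀ f → sumV Γ f ≡ sum (λ i → f (i , 0F)) + sum (λ i → f (i , 1F))
    sumV-sides f = begin
      sumV Γ f
        ≡⟨ sumV-reindex Γ (*↔× {n} {2}) f ⟩
      sum (λ i → f (remQuot {n} 2 i))
        ≡⟨ sum-* n {2} (f ∘ remQuot {n} 2) ⟩
      sum {n} (λ i → sum {2} (λ s → f (remQuot {n} 2 (combine i s))))
        ≡⟨ sum-cong-≗ {n} (λ i → trans (sum-cong-≗ {2} λ s → cong f (remQuot-combine {n} i s)) (cong (f (i , 0F) +_) (+-identityʳ _))) ⟩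
      sum (λ i → f (i , 0F) + f (i , 1F))
        ≡⟨ ∑-distrib-+ (λ i → f (i , 0F)) (λ i → f (i , 1F)) ⟩
      sum (λ i → f (i , 0F)) + sum (λ i → f (i , 1F)) ∎

    path-sum : ∀ h u v → sumV Γ (λ w → h (colour u w) (colour w v)) ≡ PathSums.pathValue h (colour u v)
    path-sum h u@(i , 0F) v@(j , 0F) = trans (sumV-sides (λ w → h (colour u w) (colour w v)))
      (PathSums.same-then-same h i j)
    path-sum h u@(i , 1F) v@(j , 1F) = trans (sumV-sides (λ w → h (colour u w) (colour w v)))
      (trans (+-comm (sum (λ t → h (cross i t) (cross t j))) _) (PathSums.same-then-same h i j))
    path-sum h u@(i , 0F) v@(j , 1F) = trans (sumV-sides (λ w → h (colour u w) (colour w v)))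
      (PathSums.mixed h i j)
    path-sum h u@(i , 1F) v@(j , 0F) = trans (sumV-sides (λ w → h (colour u w) (colour w v)))
      (trans (+-comm (sum (λ t → h (cross i t) (same t j))) _) (PathSums.mixed h i j))

    colour-CC : IsCC Γ 4 colour
    colour-CC = record
      { nonempty = λ where
          0F → (0F , 0F) , (0F , 0F) , refl
          1F → (0F , 0F) , (1F , 0F) , refl
          2F → let i , eq = find (M 0F) (subst (1 ≤_) (sym (row 0F)) (s≤s z≤n))
               in (0F , 0F) , (i , 1F) , cong oppositeSide eq
          3F → let i , eq = column-gap 0F in (i , 0F) , (0F , 1F) , cong oppositeSide eq
      ; diagonal = λ u v w eq → colour-0F v w (trans eq (colour-refl u))
      ; transpose = λ u v u′ v′ eq → trans (colour-sym v u) (trans eq (colour-sym u′ v′))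
      ; intersection = invariant⇒intersection Γ {c = colour} λ h {u} {v} {u′} {v′} eq →
          trans (path-sum h u v) (trans (cong (PathSums.pathValue h) eq) (sym (path-sum h u′ v′)))
      }

    scheme : CliqueScheme Γ (suc n′ + k) (k + k) (k′ + k′)
    scheme = record
      { colour        = colour
      ; coherent      = colour-CC
      ; reflexive     = colour-refl
      ; symmetric     = colour-sym
      ; adj-colour    = edge-colour
      ; common-colour = λ u v → trans (common-sum Γ u v)
          (trans (sumV-cong Γ λ w → cong₂ (λ s t → bit (s ∧ t)) (edge-colour u w) (edge-colour w v))
            (trans (path-sum edges₂ u v) (values (colour u v))))
      ; a≢b           = λ eq → <⇒≢ (+-mono-< (n<1+n k′) (n<1+n k′)) (sym eq)
      ; d+d           = degree-identity n′ k′
      ; separated     = λ {u} {v} → colour-separated {u} {v}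
      }
      where
      edges₂ : Fin 4 → Fin 4 → ℕ
      edges₂ i j = bit (cliqueEdge i ∧ cliqueEdge j)
      degree-identity : ∀ n k → suc n + suc k + (suc n + suc k) ≡ (2 + n) * 2 + (k + k)
      degree-identity = solve-∀
      only-common : ∀ x y z s → x * 1 + (y * 1 + z * 0 + (z * 0 + s * 0)) ≡ x + y
      only-common = solve-∀
      row-only : ∀ x y → x * 1 + y * 0 ≡ x
      row-only = solve-∀
      values : ∀ i → PathSums.pathValue edges₂ i ≡ commonCount (suc n′ + k) (k + k) (k′ + k′) i
      values 0F = only-common (suc n′) k (k ∸ k) (n ∸ k ∸ (k ∸ k))
      -- The `n′` other vertices of the clique and the `l` common points of the two blocks add up to
      -- 2k.
      values 1F = trans (only-common n′ l (k ∸ l) (n ∸ k ∸ (k ∸ l))) (sym k+k≡n′+l)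
      -- Each end lies among the `k` neighbours of the other across the cut and is not its own
      -- neighbour, which leaves k - 1 on either side.
      values 2F = cong₂ _+_ (cong (_∸ 1) (row-only k (n ∸ k))) (cong (_∸ 1) (row-only k (n ∸ k)))
      values 3F = cong₂ _+_ (row-only k (n ∸ k)) (row-only k (n ∸ k))

-- Residues and difference sets

open import Data.Integer using (ℤ; +_; -[1+_]; 0ℤ; _⊖_)
  renaming (_+_ to _+ᶻ_; _*_ to _*ᶻ_; -_ to -ᶻ_; _-_ to _-ᶻ_)

⌊⌋-cong : ∀ {P Q : Set} (p? : Dec P) (q? : Dec Q) → (P → Q) → (Q → P) → ⌊ p? ⌋ ≡ ⌊ q? ⌋
⌊⌋-cong (yes _) (yes _) _ _ = refl
⌊⌋-cong (no _)  (no _)  _ _ = refl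
⌊⌋-cong (yes p) (no ¬q) f _ = contradiction (f p) ¬q
⌊⌋-cong (no ¬p) (yes q) _ g = contradiction (g q) ¬p

-- With the quotient kept as data, closure properties of congruence become ring identities over the
-- integers.
record Congruent (n : ℕ) (a b : ℤ) : Set where
  constructor congruent
  field
    factor   : ℤ
    equation : a ≡ b +ᶻ factor *ᶻ + n

≈-reflexive : ∀ {n a b} → a ≡ b → Congruent n a b
≈-reflexive {n} {a} refl = congruent 0ℤ (identity a (+ n))
  where
  identity : ∀ a n → a ≡ a +ᶻ 0ℤ *ᶻ n
  identity = ℤ.solve-∀

≈-sym : ∀ {n a b} → Congruent n a b → Congruent n b a
≈-sym {n} {a} {b} (congruent q eq) = congruent (-ᶻ q) (begin
  b                               ≡⟨ identity b q (+ n) ⟩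
  b +ᶻ q *ᶻ + n +ᶻ -ᶻ q *ᶻ + n    ≡⟨ cong (_+ᶻ -ᶻ q *ᶻ + n) eq ⟨
  a +ᶻ -ᶻ q *ᶻ + n                ∎)
  where
  identity : ∀ b q n → b ≡ b +ᶻ q *ᶻ n +ᶻ -ᶻ q *ᶻ n
  identity = ℤ.solve-∀

≈-trans : ∀ {n a b c} → Congruent n a b → Congruent n b c → Congruent n a c
≈-trans {n} {c = c} (congruent q refl) (congruent r refl) = congruent (r +ᶻ q) (identity c q r (+ n))
  where
  identity : ∀ c q r n → c +ᶻ r *ᶻ n +ᶻ q *ᶻ n ≡ c +ᶻ (r +ᶻ q) *ᶻ n
  identity = ℤ.solve-∀

≈-+ : ∀ {n a b a′ b′} → Congruent n a b → Congruent n a′ b′ → Congruent n (a +ᶻ a′) (b +ᶻ b′)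
≈-+ {n} {b = b} {b′ = b′} (congruent q refl) (congruent r refl) = congruent (q +ᶻ r) (identity b b′ q r (+ n))
  where
  identity : ∀ b b′ q r n → b +ᶻ q *ᶻ n +ᶻ (b′ +ᶻ r *ᶻ n) ≡ b +ᶻ b′ +ᶻ (q +ᶻ r) *ᶻ n
  identity = ℤ.solve-∀

≈-neg : ∀ {n a b} → Congruent n a b → Congruent n (-ᶻ a) (-ᶻ b)
≈-neg {n} {b = b} (congruent q refl) = congruent (-ᶻ q) (identity b q (+ n))
  where
  identity : ∀ b q n → -ᶻ (b +ᶻ q *ᶻ n) ≡ -ᶻ b +ᶻ -ᶻ q *ᶻ n
  identity = ℤ.solve-∀

≈-scale : ∀ {n a b} m → Congruent n a b → Congruent (n * m) (+ m *ᶻ a) (+ m *ᶻ b)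
≈-scale {n} {b = b} m (congruent q refl) =
  congruent q (trans (identity b q (+ n) (+ m)) (cong (λ t → + m *ᶻ b +ᶻ q *ᶻ t) (sym (ℤ.pos-* n m))))
  where
  identity : ∀ b q n m → m *ᶻ (b +ᶻ q *ᶻ n) ≡ m *ᶻ b +ᶻ q *ᶻ (n *ᶻ m)
  identity = ℤ.solve-∀

≈-divisor : ∀ n m {a b} → Congruent (n * m) a b → Congruent m a b
≈-divisor n m {b = b} (congruent q refl) =
  congruent (q *ᶻ + n) (cong (b +ᶻ_) (trans (cong (q *ᶻ_) (ℤ.pos-* n m)) (sym (ℤ.*-assoc q (+ n) (+ m)))))

-- For a non-negative quotient both numbers are their own remainders; a negative quotient becomes
-- positive when the sides are swapped.
≈-ℕ : ∀ {n a b} .{{_ : NonZero n}} → a < n → b < n → Congruent n (+ a) (+ b) → a ≡ b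
≈-ℕ {n} {a} {b} a<n b<n (congruent (+ q) eq) = begin
  a               ≡⟨ m<n⇒m%n≡m a<n ⟨
  a % n           ≡⟨ cong (_% n) (ℤ.+-injective (trans eq (cong (+ b +ᶻ_) (sym (ℤ.pos-* q n))))) ⟩
  (b + q * n) % n ≡⟨ [m+kn]%n≡m%n b q n ⟩
  b % n           ≡⟨ m<n⇒m%n≡m b<n ⟩
  b               ∎
≈-ℕ a<n b<n a≈b@(congruent -[1+ q ] _) =
  sym (≈-ℕ b<n a<n (congruent (+ suc q) (Congruent.equation (≈-sym a≈b))))

⟦_⟧ : ∀ {n} → Fin n → ℤ
⟦ i ⟧ = + toℕ i

module Residues (n : ℕ) .{{_ : NonZero n}} where

  _⊞_ : Fin n → Fin n → Fin n
  _⊞_ = _+ₙ_ n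

  ⊟_ : Fin n → Fin n
  ⊟_ = -ₙ_ n

  infixl 6 _⊞_
  infix  8 ⊟_

  0# : Fin n
  0# = 0ₙ n

  infix 4 _∼_
  -- The residue `i` represents the integer `a`. Residues representing congruent integers coincide,
  -- so identities modulo `n` are proved by integer ring identities.
  record _∼_ (i : Fin n) (a : ℤ) : Set where
    constructor lift
    field lower : Congruent n ⟦ i ⟧ a
  open _∼_ public

  ∼-≈ : ∀ {i a b} → i ∼ a → Congruent n a b → i ∼ b
  ∼-≈ (lift i∼a) a≈b = lift (≈-trans i∼a a≈b)

  ∼-≡ : ∀ {i a b} → i ∼ a → a ≡ b → i ∼ b
  ∼-≡ i∼a refl = i∼a

  mod-∼ : ∀ a → a mod n ∼ + a
  mod-∼ a = lift (≈-sym (congruent (+ (a / n)) (begin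
    + a                               ≡⟨ cong +_ (m≡m%n+[m/n]*n a n) ⟩
    + (a % n) +ᶻ + (a / n * n)        ≡⟨ cong₂ _+ᶻ_ (cong +_ (sym (toℕ-fromℕ< (m%n<n a n)))) (ℤ.pos-* (a / n) n) ⟩
    ⟦ a mod n ⟧ +ᶻ + (a / n) *ᶻ + n   ∎)))

  0-∼ : 0# ∼ 0ℤ
  0-∼ = mod-∼ 0

  ⊞-∼ : ∀ {i j a b} → i ∼ a → j ∼ b → i ⊞ j ∼ a +ᶻ b
  ⊞-∼ {i} {j} (lift i∼a) (lift j∼b) = ∼-≈ (mod-∼ (toℕ i + toℕ j)) (≈-+ i∼a j∼b)

  ⊟-∼ : ∀ {i a} → i ∼ a → ⊟ i ∼ -ᶻ a
  ⊟-∼ {i} (lift i∼a) = ∼-≈ (mod-∼ (n ∸ toℕ i)) (≈-trans wrap (≈-neg i∼a))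
    where
    identity : ∀ n i → n -ᶻ i ≡ -ᶻ i +ᶻ + 1 *ᶻ n
    identity = ℤ.solve-∀
    wrap : Congruent n (+ (n ∸ toℕ i)) (-ᶻ ⟦ i ⟧)
    wrap = congruent (+ 1) (begin
      + (n ∸ toℕ i)              ≡⟨ ℤ.⊖-≥ (toℕ≤n i) ⟨
      n ⊖ toℕ i                  ≡⟨ ℤ.m-n≡m⊖n n (toℕ i) ⟨
      + n -ᶻ ⟦ i ⟧               ≡⟨ identity (+ n) ⟦ i ⟧ ⟩
      -ᶻ ⟦ i ⟧ +ᶻ + 1 *ᶻ + n     ∎)

  self : ∀ i → i ∼ ⟦ i ⟧
  self i = lift (≈-reflexive refl)

  ∼-injective : ∀ {i j a b} → i ∼ a → j ∼ b → Congruent n a b → i ≡ j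
  ∼-injective {i} {j} (lift i∼a) (lift j∼b) a≈b =
    toℕ-injective (≈-ℕ (toℕ<n i) (toℕ<n j) (≈-trans i∼a (≈-trans a≈b (≈-sym j∼b))))

  ∼-unique : ∀ {i j a b} → i ∼ a → j ∼ b → a ≡ b → i ≡ j
  ∼-unique i∼a j∼b a≡b = ∼-injective i∼a j∼b (≈-reflexive a≡b)

  ⊞-comm : ∀ i j → i ⊞ j ≡ j ⊞ i
  ⊞-comm i j = cong (_mod n) (+-comm (toℕ i) (toℕ j))

  ⊟-involutive : ∀ i → ⊟ ⊟ i ≡ i
  ⊟-involutive i = ∼-unique (⊟-∼ (⊟-∼ (self i))) (self i) (ℤ.neg-involutive ⟦ i ⟧)

  ⊟-zero : ⊟ 0# ≡ 0#
  ⊟-zero = ∼-unique (⊟-∼ 0-∼) 0-∼ refl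

  difference-zero : ∀ {i j} → i ⊞ ⊟ j ≡ 0# → i ≡ j
  difference-zero {i} {j} eq = ∼-injective (self i) (self j)
    (≈-trans (≈-reflexive (identity ⟦ i ⟧ ⟦ j ⟧))
      (≈-trans (≈-+ {b = 0ℤ} (≈-trans (≈-sym (lower (⊞-∼ (self i) (⊟-∼ (self j))))) (lower (subst (_∼ 0ℤ) (sym eq) 0-∼)))
                    (≈-reflexive {b = ⟦ j ⟧} refl))
        (≈-reflexive (ℤ.+-identityˡ ⟦ j ⟧))))
    where
    identity : ∀ i j → i ≡ i -ᶻ j +ᶻ j
    identity = ℤ.solve-∀

  self-difference : ∀ i → i ⊞ ⊟ i ≡ 0#
  self-difference i = ∼-unique (⊞-∼ (self i) (⊟-∼ (self i))) 0-∼ (ℤ.+-inverseʳ ⟦ i ⟧)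

-- The symmetric design of a difference set

module DifferenceSetGraph (n : ℕ) .{{_ : NonZero n}} (D : Fin n → Bool) where
  open Residues n

  -- For the rotation with exponent `i` and the reflection with exponent `j` the quotient is x^(i+j)
  -- y, which lies in yD exactly when -(i + j) is in `D`. The sum makes the matrix symmetric.
  incidence : Fin n → Fin n → Bool
  incidence i j = D (⊟ (i ⊞ j))

  incidence-sym : ∀ i j → incidence i j ≡ incidence j i
  incidence-sym i j = cong (D ∘ ⊟_) (⊞-comm i j)

  -- Row `i` of the incidence matrix is `D` composed with this involution, so sums along a row can
  -- be reindexed as sums over the argument of `D`.
  reflection : Fin n → Fin n ↔ Fin n
  reflection i = mk↔ₛ′ reflect reflect involutive involutive
    where
    reflect : Fin n → Fin n
    reflect t = ⊟ (i ⊞ t)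
    identity : ∀ i t → -ᶻ (i +ᶻ -ᶻ (i +ᶻ t)) ≡ t
    identity = ℤ.solve-∀
    involutive : ∀ t → reflect (reflect t) ≡ t
    involutive t = ∼-unique (⊟-∼ (⊞-∼ (self i) (⊟-∼ (⊞-∼ (self i) (self t))))) (self t) (identity ⟦ i ⟧ ⟦ t ⟧)

  incidence-row : ∀ i → # (incidence i) ≡ # D
  incidence-row i = sym (∑-permute (bit ∘ D) (reflection i))

  -- The number of representations of `h` as a difference d′ - d within `D`, indexed by `d` alone.
  translates : Fin n → ℕ
  translates h = # (λ d → D d ∧ D (d ⊞ h))

  -- Put d = -(i + t). Then -(t + j) = d + (i - j), and `d` runs over all residues as `t` does.
  incidence-pair : ∀ i j → # (λ t → incidence i t ∧ incidence t j) ≡ translates (i ⊞ ⊟ j)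
  incidence-pair i j = trans
    (sum-cong-≗ λ t → cong (λ z → bit (incidence i t ∧ D z)) (shift t))
    (sym (∑-permute (λ d → bit (D d ∧ D (d ⊞ (i ⊞ ⊟ j)))) (reflection i)))
    where
    identity : ∀ i j t → -ᶻ (t +ᶻ j) ≡ -ᶻ (i +ᶻ t) +ᶻ (i -ᶻ j)
    identity = ℤ.solve-∀
    shift : ∀ t → ⊟ (t ⊞ j) ≡ ⊟ (i ⊞ t) ⊞ (i ⊞ ⊟ j)
    shift t = ∼-unique (⊟-∼ (⊞-∼ (self t) (self j)))
      (⊞-∼ (⊟-∼ (⊞-∼ (self i) (self t))) (⊞-∼ (self i) (⊟-∼ (self j)))) (identity ⟦ i ⟧ ⟦ j ⟧ ⟦ t ⟧)

  module _ {k l : ℕ} (differenceSet : IsDifferenceSet n D n k l) where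

    difference-set-size : # D ≡ k
    difference-set-size = trans (sym (count-sum D)) (proj₁ (proj₂ differenceSet))

    1≤multiplicity : 1 ≤ l
    1≤multiplicity = proj₁ (proj₂ (proj₂ differenceSet))

    -- The equality test in IsDifferenceSet is local to that definition, so its
    -- counting predicate is recovered from the hypothesis by unification.
    counting : Σ (Fin n → Fin (n * n) → Bool) λ p → ∀ h → h ≢ 0# → count (n * n) (p h) ≡ l
    counting = _ , proj₂ (proj₂ (proj₂ differenceSet))

    isPair : Fin n → Fin (n * n) → Bool
    isPair = proj₁ counting

    -- Both dihedral elements compared are rotations, so only their exponents matter.
    isPair-spec : ∀ h p → let d , d′ = remQuot {n} n p in
      isPair h p ≡ D d ∧ D d′ ∧ ⌊ (⊟ d ⊞ d′) ≟ h ⌋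
    isPair-spec h p with (⊟ (proj₁ (remQuot {n} n p)) ⊞ proj₂ (remQuot {n} n p)) ≟ h
    ... | yes refl = refl
    ... | no _     = refl

    -- Given `d` and `h`, the only solution of -d + d′ = h is d′ = d + h, so the count over pairs
    -- collapses to a count over `d`.
    difference-set-translates : ∀ h → h ≢ 0# → translates h ≡ l
    difference-set-translates h h≢0 = begin
      translates h
        ≡⟨ sum-cong-≗ (λ d → sum-single (d ⊞ h) (λ d′ → bit (D d ∧ D d′))) ⟨
      sum (λ d → sum (λ d′ → if ⌊ d ⊞ h ≟ d′ ⌋ then bit (D d ∧ D d′) else 0))
        ≡⟨ sum-cong-≗ (λ d → sum-cong-≗ λ d′ → restrict (D d) (D d′) (⌊⌋-cong (d ⊞ h ≟ d′) (⊟ d ⊞ d′ ≟ h) (to d) (from d d′))) ⟩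
      sum (λ d → sum (λ d′ → bit (solves (d , d′))))
        ≡⟨ sum-cong-≗ (λ d → sum-cong-≗ λ d′ → cong (bit ∘ solves) (remQuot-combine {n} d d′)) ⟨
      sum {n} (λ d → sum {n} (λ d′ → bit (solves (remQuot {n} n (combine d d′)))))
        ≡⟨ sum-* n {n} (bit ∘ solves ∘ remQuot {n} n) ⟨
      sum (bit ∘ solves ∘ remQuot {n} n)
        ≡⟨ sum-cong-≗ (λ p → cong bit (isPair-spec h p)) ⟨
      sum (bit ∘ isPair h)
        ≡⟨ count-sum (isPair h) ⟨
      count (n * n) (isPair h)
        ≡⟨ proj₂ counting h h≢0 ⟩
      l ∎
      where
      solves : Fin n × Fin n → Bool
      solves (d , d′) = D d ∧ D d′ ∧ ⌊ ⊟ d ⊞ d′ ≟ h ⌋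
      restrict : ∀ x y {b c} → b ≡ c → (if b then bit (x ∧ y) else 0) ≡ bit (x ∧ y ∧ c)
      restrict true  true  {true}  refl = refl
      restrict true  true  {false} refl = refl
      restrict true  false {true}  refl = refl
      restrict true  false {false} refl = refl
      restrict false _     {true}  refl = refl
      restrict false _     {false} refl = refl
      to : ∀ d {d′} → d ⊞ h ≡ d′ → ⊟ d ⊞ d′ ≡ h
      to d refl = ∼-unique (⊞-∼ (⊟-∼ (self d)) (⊞-∼ (self d) (self h))) (self h) (identity ⟦ d ⟧ ⟦ h ⟧)
        where
        identity : ∀ d h → -ᶻ d +ᶻ (d +ᶻ h) ≡ h
        identity = ℤ.solve-∀
      from : ∀ d d′ → ⊟ d ⊞ d′ ≡ h → d ⊞ h ≡ d′
      from d d′ refl = ∼-unique (⊞-∼ (self d) (⊞-∼ (⊟-∼ (self d)) (self d′))) (self d′) (identity ⟦ d ⟧ ⟦ d′ ⟧)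
        where
        identity : ∀ d d′ → d +ᶻ (-ᶻ d +ᶻ d′) ≡ d′
        identity = ℤ.solve-∀

-- Dihedral Cayley graphs

module _ (n : ℕ) .{{_ : NonZero n}} (D : Fin n → Bool) where
  open Residues n
  open DifferenceSetGraph n D

  ⊟-zero-test : ∀ i → ⌊ ⊟ i ≟ 0# ⌋ ≡ ⌊ i ≟ 0# ⌋
  ⊟-zero-test i = ⌊⌋-cong (⊟ i ≟ 0#) (i ≟ 0#)
    (λ eq → trans (sym (⊟-involutive i)) (trans (cong ⊟_ eq) ⊟-zero))
    (λ eq → trans (cong ⊟_ eq) ⊟-zero)

  ΓD-Cayley : IsDihCayley n (ΓD n D)
  ΓD-Cayley = record
    { S      = SD n D
    ; noId   = cong not (≟-refl 0#)
    ; invCl  = λ where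
        (i , 0F) → cong not (⊟-zero-test i)
        (i , 1F) → refl
    ; iso    = ↔-id _
    ; isoAdj = λ _ _ → refl
    }

  rotation-edge : ∀ i j → SD n D (j ⊞ ⊟ i , 0F) ≡ not ⌊ i ≟ j ⌋
  rotation-edge i j = cong not (⌊⌋-cong (j ⊞ ⊟ i ≟ 0#) (i ≟ j)
    (sym ∘ difference-zero) (λ where refl → self-difference i))

  -- The exponent `z` stays general because the two orders of the ends give different expressions
  -- for the residue i + j.
  reflection-edge : ∀ i j {z} → z ∼ ⟦ i ⟧ +ᶻ ⟦ j ⟧ → SD n D (z , 1F) ≡ incidence i j
  reflection-edge i j z∼ = cong D (∼-unique (⊞-∼ 0-∼ (⊟-∼ z∼)) (⊟-∼ (⊞-∼ (self i) (self j)))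
    (ℤ.+-identityˡ (-ᶻ (⟦ i ⟧ +ᶻ ⟦ j ⟧))))

-- K_m[Cay(G, S)] is a Cayley graph of the dihedral group H ⊇ G with index m,
-- for the connection set (H ∖ G) ∪ S; its copies of Cay(G, S) are the right
-- cosets G x^r, where G is generated by x^m and y.
module LexCayley (n m : ℕ) .{{_ : NonZero n}} .{{_ : NonZero m}} .{{_ : NonZero (n * m)}}
  {Γ : Graph} (cayley : IsDihCayley n Γ) where
  open IsDihCayley cayley

  private
    module N = Residues n
    module M = Residues m
    module NM = Residues (n * m)

  -- Here z = m i + r; the element lies in the subgroup generated by x^m and y exactly when r = 0,
  -- and then `i` is its exponent in that copy of G.
  S⁺ : Dih (n * m) → Bool
  S⁺ (z , b) with remQuot {n} m z
  ... | i , r = if ⌊ r ≟ M.0# ⌋ then S (i , b) else true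

  combine-∼ : ∀ {i a} (r : Fin m) → i N.∼ a → combine i r NM.∼ + m *ᶻ a +ᶻ ⟦ r ⟧
  combine-∼ {i} r (N.lift i∼a) = NM.lift (≈-trans
    (≈-reflexive (begin
      ⟦ combine i r ⟧             ≡⟨ cong +_ (toℕ-combine i r) ⟩
      + (m * toℕ i + toℕ r)       ≡⟨ cong (_+ᶻ ⟦ r ⟧) (ℤ.pos-* m (toℕ i)) ⟩
      + m *ᶻ ⟦ i ⟧ +ᶻ ⟦ r ⟧       ∎))
    (≈-+ (≈-scale m i∼a) (≈-reflexive refl)))

  S⁺-combine : ∀ i r b → S⁺ (combine i r , b) ≡ (if ⌊ r ≟ M.0# ⌋ then S (i , b) else true)
  S⁺-combine i r b = cong (λ (i , r) → if ⌊ r ≟ M.0# ⌋ then S (i , b) else true) (remQuot-combine i r)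

  as-combine : ∀ z → ∃ λ i → ∃ λ r → z ≡ combine i r
  as-combine z = let i , r = remQuot {n} m z in i , r , sym (combine-remQuot {n} m z)

  toℕ-0 : ⟦ M.0# ⟧ ≡ 0ℤ
  toℕ-0 = cong +_ (trans (toℕ-fromℕ< (m%n<n 0 m)) (m*n%n≡0 0 m))

  S⁺-inside : ∀ {z i b a} → z NM.∼ + m *ᶻ a → i N.∼ a → S⁺ (z , b) ≡ S (i , b)
  S⁺-inside {z} {i} {b} {a} z∼ i∼ = begin
    S⁺ (z , b)
      ≡⟨ cong (λ z → S⁺ (z , b)) (NM.∼-unique z∼ (combine-∼ M.0# i∼)
           (sym (trans (cong (+ m *ᶻ a +ᶻ_) toℕ-0) (ℤ.+-identityʳ (+ m *ᶻ a))))) ⟩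
    S⁺ (combine i M.0# , b)
      ≡⟨ S⁺-combine i M.0# b ⟩
    (if ⌊ M.0# ≟ M.0# ⌋ then S (i , b) else true)
      ≡⟨ cong (λ t → if t then S (i , b) else true) (≟-refl M.0#) ⟩
    S (i , b) ∎

  ≈-drop : ∀ a c → Congruent m (+ m *ᶻ a +ᶻ c) c
  ≈-drop a c = congruent a (identity (+ m) a c)
    where
    identity : ∀ m a c → m *ᶻ a +ᶻ c ≡ c +ᶻ a *ᶻ m
    identity = ℤ.solve-∀

  -- Reduction modulo `m` removes the multiples of `m`, so the remainder of `z` is congruent to `c`
  -- and therefore nonzero.
  S⁺-outside : ∀ {z b c} a → z NM.∼ + m *ᶻ a +ᶻ c → ¬ Congruent m c 0ℤ → S⁺ (z , b) ≡ true
  S⁺-outside {z} {b} {c} a z∼ c≉0 with i , r , refl ← as-combine z =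
    trans (S⁺-combine i r b) (cong (λ t → if t then S (i , b) else true) (≟-≢ r≢0))
    where
    r∼c : Congruent m ⟦ r ⟧ c
    r∼c = ≈-trans (≈-sym (≈-drop ⟦ i ⟧ ⟦ r ⟧))
      (≈-trans (≈-sym (≈-divisor n m (NM.lower (combine-∼ r (N.self i)))))
        (≈-trans (≈-divisor n m (NM.lower z∼)) (≈-drop a c)))
    r≢0 : r ≢ M.0#
    r≢0 refl = c≉0 (≈-trans (≈-sym r∼c) (≈-reflexive toℕ-0))

  S⁺-noId : S⁺ (e (n * m)) ≡ false
  S⁺-noId = trans (S⁺-inside (NM.∼-≡ NM.0-∼ (sym (ℤ.*-zeroʳ (+ m)))) N.0-∼) noId

  S⁺-inverse : ∀ g → S⁺ (_⁻¹ (n * m) g) ≡ S⁺ g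
  S⁺-inverse (z , 1F) = refl
  S⁺-inverse (z , 0F) with i , r , refl ← as-combine z with r ≟ M.0#
  ... | yes refl = begin
    S⁺ (NM.⊟ combine i M.0# , 0F) ≡⟨ S⁺-inside (NM.∼-≡ (NM.⊟-∼ z∼) (ℤ.neg-distribʳ-* (+ m) ⟦ i ⟧)) (N.⊟-∼ (N.self i)) ⟩
    S (N.⊟ i , 0F)                ≡⟨ invCl (i , 0F) ⟩
    S (i , 0F)                    ≡⟨ S⁺-inside z∼ (N.self i) ⟨
    S⁺ (combine i M.0# , 0F)      ∎
    where
    z∼ : combine i M.0# NM.∼ + m *ᶻ ⟦ i ⟧
    z∼ = NM.∼-≡ (combine-∼ M.0# (N.self i)) (trans (cong (+ m *ᶻ ⟦ i ⟧ +ᶻ_) toℕ-0) (ℤ.+-identityʳ (+ m *ᶻ ⟦ i ⟧)))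
  ... | no r≢0 = trans
    (S⁺-outside (-ᶻ ⟦ i ⟧) (NM.∼-≡ (NM.⊟-∼ z∼) (identity (+ m) ⟦ i ⟧ ⟦ r ⟧))
      λ -r≈0 → r≉0 (≈-trans (≈-reflexive (sym (ℤ.neg-involutive ⟦ r ⟧))) (≈-neg -r≈0)))
    (sym (S⁺-outside ⟦ i ⟧ z∼ r≉0))
    where
    z∼ : combine i r NM.∼ + m *ᶻ ⟦ i ⟧ +ᶻ ⟦ r ⟧
    z∼ = combine-∼ r (N.self i)
    identity : ∀ m i r → -ᶻ (m *ᶻ i +ᶻ r) ≡ m *ᶻ -ᶻ i +ᶻ -ᶻ r
    identity = ℤ.solve-∀
    r≉0 : ¬ Congruent m ⟦ r ⟧ 0ℤ
    r≉0 r≈0 = r≢0 (M.∼-injective (M.self r) M.0-∼ r≈0)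

  -- This is g ↦ g x^r. For a reflection, x^(mi) y x^r = x^(mi - r) y, and mi - r is the negative of
  -- m(-i) + r.
  embed : Fin m × Dih n → Dih (n * m)
  embed (r , i , 0F) = combine i r , 0F
  embed (r , i , 1F) = NM.⊟ combine (N.⊟ i) r , 1F

  coset : (Fin m × Dih n) ↔ Dih (n * m)
  coset = mk↔ₛ′ embed back embed-back back-embed
    where
    back : Dih (n * m) → Fin m × Dih n
    back (z , 0F) = let i , r = remQuot {n} m z in r , i , 0F
    back (z , 1F) = let i , r = remQuot {n} m (NM.⊟ z) in r , N.⊟ i , 1F
    embed-back : ∀ g → embed (back g) ≡ g
    embed-back (z , 0F) = cong (_, 0F) (combine-remQuot {n} m z)
    embed-back (z , 1F) = cong (_, 1F) (begin
      NM.⊟ combine (N.⊟ N.⊟ i) r ≡⟨ cong (λ i → NM.⊟ combine i r) (N.⊟-involutive i) ⟩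
      NM.⊟ combine i r           ≡⟨ cong NM.⊟_ (combine-remQuot {n} m (NM.⊟ z)) ⟩
      NM.⊟ NM.⊟ z                ≡⟨ NM.⊟-involutive z ⟩
      z                          ∎)
      where
      i = proj₁ (remQuot {n} m (NM.⊟ z))
      r = proj₂ (remQuot {n} m (NM.⊟ z))
    back-embed : ∀ g → back (embed g) ≡ g
    back-embed (r , i , 0F) = cong (λ (i , r) → r , i , 0F) (remQuot-combine i r)
    back-embed (r , i , 1F) = begin
      back (NM.⊟ combine (N.⊟ i) r , 1F)
        ≡⟨ cong (λ z → let i , r = remQuot {n} m z in r , N.⊟ i , 1F) (NM.⊟-involutive (combine (N.⊟ i) r)) ⟩
      (let i , r = remQuot {n} m (combine (N.⊟ i) r) in r , N.⊟ i , 1F)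
        ≡⟨ cong (λ (i , r) → r , N.⊟ i , 1F) (remQuot-combine (N.⊟ i) r) ⟩
      (r , N.⊟ N.⊟ i , 1F)
        ≡⟨ cong (λ i → r , i , 1F) (N.⊟-involutive i) ⟩
      (r , i , 1F) ∎

  inCopy : Fin m → Fin m → Bool → Bool
  inCopy p q b = not ⌊ p ≟ q ⌋ ∨ (⌊ p ≟ q ⌋ ∧ b)

  -- Modulo `m` the exponent is q - p, which vanishes only for equal cosets; then `a` is the
  -- exponent within G.
  S⁺-cosets : ∀ {z i b} p q a → z NM.∼ + m *ᶻ a +ᶻ (⟦ q ⟧ -ᶻ ⟦ p ⟧) → i N.∼ a →
    inCopy p q (S (i , b)) ≡ S⁺ (z , b)
  S⁺-cosets {z} {i} {b} p q a z∼ i∼ with p ≟ q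
  ... | yes refl = sym (S⁺-inside (NM.∼-≡ z∼ (identity (+ m *ᶻ a) ⟦ p ⟧)) i∼)
    where
    identity : ∀ x p → x +ᶻ (p -ᶻ p) ≡ x
    identity = ℤ.solve-∀
  ... | no p≢q = sym (S⁺-outside a z∼ λ q-p≈0 → p≢q (sym (M.∼-injective (M.self q) (M.self p)
          (≈-trans (≈-reflexive (identity ⟦ q ⟧ ⟦ p ⟧)) (≈-trans (≈-+ q-p≈0 (≈-reflexive {b = ⟦ p ⟧} refl)) (≈-reflexive (ℤ.+-identityˡ ⟦ p ⟧)))))))
    where
    identity : ∀ q p → q ≡ q -ᶻ p +ᶻ p
    identity = ℤ.solve-∀

  inCopy-sym : ∀ p q b → inCopy p q b ≡ inCopy q p b
  inCopy-sym p q b = cong (λ t → not t ∨ (t ∧ b)) (⌊⌋-cong (p ≟ q) (q ≟ p) sym sym)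

  -- The quotient is h x^(q-p) g⁻¹. Moving the power of x past a reflection `h` inverts it, so in
  -- those cases the roles of `p` and `q` are exchanged.
  coset-adj : ∀ p q g h →
    inCopy p q (CayAdj n S g h) ≡ CayAdj (n * m) S⁺ (embed (p , g)) (embed (q , h))
  coset-adj p q (i , 0F) (j , 0F) = S⁺-cosets p q (⟦ j ⟧ -ᶻ ⟦ i ⟧)
    (NM.∼-≡ (NM.⊞-∼ (combine-∼ q (N.self j)) (NM.⊟-∼ (combine-∼ p (N.self i)))) (identity (+ m) ⟦ i ⟧ ⟦ j ⟧ ⟦ p ⟧ ⟦ q ⟧))
    (N.⊞-∼ (N.self j) (N.⊟-∼ (N.self i)))
    where
    identity : ∀ m i j p q → m *ᶻ j +ᶻ q +ᶻ -ᶻ (m *ᶻ i +ᶻ p) ≡ m *ᶻ (j -ᶻ i) +ᶻ (q -ᶻ p)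
    identity = ℤ.solve-∀
  coset-adj p q (i , 1F) (j , 0F) = S⁺-cosets p q (⟦ j ⟧ +ᶻ ⟦ i ⟧)
    (NM.∼-≡ (NM.⊞-∼ (combine-∼ q (N.self j)) (NM.⊟-∼ (combine-∼ p (N.⊟-∼ (N.self i))))) (identity (+ m) ⟦ i ⟧ ⟦ j ⟧ ⟦ p ⟧ ⟦ q ⟧))
    (N.⊞-∼ (N.self j) (N.self i))
    where
    identity : ∀ m i j p q → m *ᶻ j +ᶻ q +ᶻ -ᶻ (m *ᶻ -ᶻ i +ᶻ p) ≡ m *ᶻ (j +ᶻ i) +ᶻ (q -ᶻ p)
    identity = ℤ.solve-∀
  coset-adj p q (i , 0F) (j , 1F) = trans (inCopy-sym p q _) (S⁺-cosets q p (⟦ j ⟧ +ᶻ -ᶻ -ᶻ ⟦ i ⟧)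
    (NM.∼-≡ (NM.⊞-∼ (NM.⊟-∼ (combine-∼ q (N.⊟-∼ (N.self j)))) (NM.⊟-∼ (NM.⊟-∼ (combine-∼ p (N.self i))))) (identity (+ m) ⟦ i ⟧ ⟦ j ⟧ ⟦ p ⟧ ⟦ q ⟧))
    (N.⊞-∼ (N.self j) (N.⊟-∼ (N.⊟-∼ (N.self i)))))
    where
    identity : ∀ m i j p q → -ᶻ (m *ᶻ -ᶻ j +ᶻ q) +ᶻ -ᶻ -ᶻ (m *ᶻ i +ᶻ p) ≡ m *ᶻ (j +ᶻ -ᶻ -ᶻ i) +ᶻ (p -ᶻ q)
    identity = ℤ.solve-∀
  coset-adj p q (i , 1F) (j , 1F) = trans (inCopy-sym p q _) (S⁺-cosets q p (⟦ j ⟧ -ᶻ ⟦ i ⟧)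
    (NM.∼-≡ (NM.⊞-∼ (NM.⊟-∼ (combine-∼ q (N.⊟-∼ (N.self j)))) (NM.⊟-∼ (NM.⊟-∼ (combine-∼ p (N.⊟-∼ (N.self i)))))) (identity (+ m) ⟦ i ⟧ ⟦ j ⟧ ⟦ p ⟧ ⟦ q ⟧))
    (N.⊞-∼ (N.self j) (N.⊟-∼ (N.self i))))
    where
    identity : ∀ m i j p q → -ᶻ (m *ᶻ -ᶻ j +ᶻ q) +ᶻ -ᶻ -ᶻ (m *ᶻ -ᶻ i +ᶻ p) ≡ m *ᶻ (j -ᶻ i) +ᶻ (p -ᶻ q)
    identity = ℤ.solve-∀

  lex-Cayley : IsDihCayley (n * m) (Lex (K m) Γ)
  lex-Cayley = record
    { S      = S⁺
    ; noId   = S⁺-noId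
    ; invCl  = S⁺-inverse
    ; iso    = coset ↔-∘ (↔-id _ ×-↔ iso)
    ; isoAdj = λ (p , x) (q , y) → trans (cong (inCopy p q) (isoAdj x y))
        (coset-adj p q (Inverse.to iso x) (Inverse.to iso y))
    }

lex-dihedrant : ∀ n m .{{_ : NonZero n}} .{{_ : NonZero m}} {Γ} → IsDihCayley n Γ → IsDihedrant (Lex (K m) Γ)
lex-dihedrant n m cayley = n * m , nm≢0 , LexCayley.lex-Cayley n m cayley
  where instance nm≢0 = m*n≢0 n m

-- Γ(D) and K₄ × K₂ as clique schemes

cliqueEdge-sameSide : ∀ b → cliqueEdge (sameSide b) ≡ not b
cliqueEdge-sameSide true  = refl
cliqueEdge-sameSide false = refl

cliqueEdge-oppositeSide : ∀ b → cliqueEdge (oppositeSide b) ≡ b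
cliqueEdge-oppositeSide true  = refl
cliqueEdge-oppositeSide false = refl

ΓD-scheme : ∀ n′ (D : Fin (2 + n′) → Bool) k′ {l} →
  IsDifferenceSet (2 + n′) D (2 + n′) (suc k′) l →
  suc k′ < 2 + n′ → suc k′ + suc k′ ≡ n′ + l →
  CliqueScheme (ΓD (2 + n′) D) (suc n′ + suc k′) (suc k′ + suc k′) (k′ + k′)
ΓD-scheme n′ D k′ {l} ds k<n k+k≡n′+l = scheme (DihEnum n) (_≟V_ (ΓD n D)) (adj (ΓD n D)) edges
  where
  n = 2 + n′
  open Residues n
  open DifferenceSetGraph n D
  row : ∀ i → # (incidence i) ≡ suc k′
  row i = trans (incidence-row i) (difference-set-size ds)
  pair : ∀ i j → i ≢ j → # (λ t → incidence i t ∧ incidence t j) ≡ l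
  pair i j i≢j = trans (incidence-pair i j)
    (difference-set-translates ds (i ⊞ ⊟ j) (i≢j ∘ difference-zero))
  open TwoCliques incidence incidence-sym row pair k<n k+k≡n′+l
  edges : ∀ u v → adj (ΓD n D) u v ≡ cliqueEdge (colour u v)
  edges (i , 0F) (j , 0F) = trans (rotation-edge n D i j) (sym (cliqueEdge-sameSide ⌊ i ≟ j ⌋))
  edges (i , 1F) (j , 1F) = trans (rotation-edge n D i j) (sym (cliqueEdge-sameSide ⌊ i ≟ j ⌋))
  edges (i , 0F) (j , 1F) = trans
    (reflection-edge n D i j (∼-≡ (⊞-∼ (self j) (⊟-∼ (⊟-∼ (self i)))) (identity ⟦ i ⟧ ⟦ j ⟧)))
    (sym (cliqueEdge-oppositeSide (incidence i j)))
    where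
    identity : ∀ i j → j +ᶻ -ᶻ -ᶻ i ≡ i +ᶻ j
    identity = ℤ.solve-∀
  edges (i , 1F) (j , 0F) = trans
    (reflection-edge n D i j (∼-≡ (⊞-∼ (self j) (self i)) (ℤ.+-comm ⟦ j ⟧ ⟦ i ⟧)))
    (sym (cliqueEdge-oppositeSide (incidence i j)))

prism : Graph
prism = Cart (K 4) (K 2)

-- The matching is the identity matrix, a degenerate design with n = 4 and disjoint blocks of size
-- one; the balance of its parameters reads 1 + 1 = 2 + 0.
prism-scheme : CliqueScheme prism 4 2 0
prism-scheme = scheme (enum prism) (_≟V_ prism) (adj prism) edges
  where
  matching : Fin 4 → Fin 4 → Bool
  matching i j = ⌊ i ≟ j ⌋
  matching-sym : ∀ i j → matching i j ≡ matching j i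
  matching-sym = from-yes (all? λ i → all? λ j → matching i j Bool.≟ matching j i)
  row : ∀ i → # (matching i) ≡ 1
  row = from-yes (all? λ i → # (matching i) ℕ.≟ 1)
  pair : ∀ i j → i ≢ j → # (λ t → matching i t ∧ matching t j) ≡ 0
  pair = from-yes (all? λ i → all? λ j →
    ¬? (i ≟ j) →-dec (# (λ t → matching i t ∧ matching t j) ℕ.≟ 0))
  open TwoCliques matching matching-sym row pair (s≤s (s≤s z≤n)) refl
  edges : ∀ u v → adj prism u v ≡ cliqueEdge (colour u v)
  edges (i , s) (j , t) = from-yes (all? λ i → all? λ s → all? λ j → all? λ t →
    adj prism (i , s) (j , t) Bool.≟ cliqueEdge (colour (i , s) (j , t))) i s j t

-- K₄ × K₂ is Γ({e}) for n = 4, up to inverting the rotation exponent in the second clique.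
prism-Cayley : IsDihCayley 4 prism
prism-Cayley = record
  { S      = connection
  ; noId   = refl
  ; invCl  = λ (i , s) → from-yes (all? λ i → all? λ s →
      connection (_⁻¹ 4 (i , s)) Bool.≟ connection (i , s)) i s
  ; iso    = mk↔ₛ′ invert invert involutive involutive
  ; isoAdj = λ (i , s) (j , t) → from-yes (all? λ i → all? λ s → all? λ j → all? λ t →
      adj prism (i , s) (j , t) Bool.≟
      CayAdj 4 connection (invert (i , s)) (invert (j , t))) i s j t
  }
  where
  open Residues 4
  connection : Dih 4 → Bool
  connection = SD 4 (λ i → ⌊ i ≟ 0F ⌋)
  invert : Dih 4 → Dih 4
  invert (i , 0F) = i , 0F
  invert (i , 1F) = ⊟ i , 1F
  involutive : ∀ g → invert (invert g) ≡ g
  involutive (i , 0F) = refl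
  involutive (i , 1F) = cong (_, 1F) (⊟-involutive i)

-- Arithmetic of the parameters and assembly of the theorem

module _ {n′ k s : ℕ} (2k+1+s≡2n : 2 * k + 1 + s ≡ 2 * (2 + n′)) where

  block-size-bound : k < 2 + n′
  block-size-bound = *-cancelˡ-< 2 k (2 + n′) (subst (2 * k <_) 2k+1+s≡2n
    (m≤n⇒m≤n+o s (≤-reflexive (+-comm 1 (2 * k)))))

  -- Eliminate `s`: from 2k = 2n - 1 - s and l = n + 1 - s follows 2k = n - 2 + l.
  clique-balance : ∀ {l} → l + s ≡ 2 + n′ + 1 → k + k ≡ n′ + l
  clique-balance {l} l+s≡n+1 = +-cancelʳ-≡ (1 + s) (k + k) (n′ + l) (begin
    k + k + (1 + s)      ≡⟨ left k s ⟩
    2 * k + 1 + s        ≡⟨ 2k+1+s≡2n ⟩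
    2 * (2 + n′)         ≡⟨ middle n′ ⟩
    n′ + (2 + n′ + 1) + 1 ≡⟨ cong (λ t → n′ + t + 1) l+s≡n+1 ⟨
    n′ + (l + s) + 1     ≡⟨ right n′ l s ⟩
    n′ + l + (1 + s)     ∎)
    where
    left : ∀ k s → k + k + (1 + s) ≡ 2 * k + 1 + s
    left = solve-∀
    middle : ∀ n → 2 * (2 + n) ≡ n + (2 + n + 1) + 1
    middle = solve-∀
    right : ∀ n l s → n + (l + s) + 1 ≡ n + l + (1 + s)
    right = solve-∀

lex-scheme-properties : ∀ m {n Γ d a b} .{{_ : NonZero n}} → CliqueScheme Γ d a b → IsDihCayley n Γ →
  IsStrictlyDeza (Lex (K (2 + m)) Γ) × IsDihedrant (Lex (K (2 + m)) Γ) × WLRank (Lex (K (2 + m)) Γ) 5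
lex-scheme-properties m {n} scheme cayley = strictlyDeza , lex-dihedrant n (2 + m) cayley , rank-5
  where open LexCliqueScheme m scheme

theorem1p2 : (m : ℕ) → 2 ≤ m →
    ((n : ℕ) → {{_ : NonZero n}} → 3 ≤ n →
    (D : Fin n → Bool) →
    (s k l : ℕ) → s * s ≡ 8 * n ∸ 7 → 2 * k + 1 + s ≡ 2 * n → l + s ≡ n + 1 →
    IsDifferenceSet n D n k l →
    IsStrictlyDeza (Lex (K m) (ΓD n D)) ×
    IsDihedrant (Lex (K m) (ΓD n D)) ×
    WLRank (Lex (K m) (ΓD n D)) 5)
    ×
    (IsStrictlyDeza (Lex (K m) (Cart (K 4) (K 2))) ×
    IsDihedrant (Lex (K m) (Cart (K 4) (K 2))) ×
    WLRank (Lex (K m) (Cart (K 4) (K 2))) 5)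
theorem1p2 (suc (suc m)) _ = part-1 , lex-scheme-properties m prism-scheme prism-Cayley
  where
  part-1 : (n : ℕ) → {{_ : NonZero n}} → 3 ≤ n →
    (D : Fin n → Bool) →
    (s k l : ℕ) → s * s ≡ 8 * n ∸ 7 → 2 * k + 1 + s ≡ 2 * n → l + s ≡ n + 1 →
    IsDifferenceSet n D n k l →
    IsStrictlyDeza (Lex (K (2 + m)) (ΓD n D)) ×
    IsDihedrant (Lex (K (2 + m)) (ΓD n D)) ×
    WLRank (Lex (K (2 + m)) (ΓD n D)) 5
  part-1 (suc (suc n′)) _ D s (suc k′) l _ size-eq multiplicity-eq ds =
    lex-scheme-properties m
      (ΓD-scheme n′ D k′ ds (block-size-bound {k = suc k′} size-eq) (clique-balance {k = suc k′} size-eq multiplicity-eq))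
      (ΓD-Cayley _ D)
  -- An empty `D` would give 0 = n′ + l, although the multiplicity `l` is positive.
  part-1 (suc (suc n′)) _ D s zero l _ size-eq multiplicity-eq ds =
    contradiction (clique-balance {k = zero} size-eq multiplicity-eq)
      (<⇒≢ (m≤n⇒m≤o+n n′ (DifferenceSetGraph.1≤multiplicity (2 + n′) D ds)))
  part-1 (suc zero) (s≤s ())
theorem1p2 (suc zero) (s≤s ())
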